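{- Let $p$ be a prime, let $k\ge 2$ be an integer, and let $\mathcal D$ be a connected LC instance. Then $\mathcal D$ has a solution in the minion $\mathcal V_k\text{ - }\mathbb Z_p$ if and only if the $k$-th saturated power $\mathrm{pow}_k\,\mathcal D$ of $\mathcal D$ has a solution in the minion $\mathcal Z_p$.
   Context: An LC (label cover) instance $\mathcal D$ consists of a finite set $X$ of variables, a finite set $\mathcal D_x$ (domain) for each $x\in X$, and a finite list of constraints of the form $x=\alpha(y)$ with $x,y\in X$ and $\alpha:\mathcal D_y\to\mathcal D_x$ a function. It is connected if the multigraph with vertex set $X$ and an edge between $x$ and $y$ for each constraint $x=\alpha(y)$ is connected. A minion $\mathcal R$ is a functor from finite sets to sets: it assigns a set $\mathcal R^{(D)}$ to each finite set $D$ and a map $\mathcal R^{(\alpha)}:\mathcal R^{(D)}\to\mathcal R^{(E)}$ to each function $\alpha:D\to E$ between finite sets, preserving identities and composition. A solution of $\mathcal D$ in $\mathcal R$ is a tuple $(r_x)_{x\in X}$ with $r_x\in\mathcal R^{(\mathcal D_x)}$ and $r_x=\mathcal R^{(\alpha)}(r_y)$ for every constraint $x=\alpha(y)$ of $\mathcal D$. The $k$-th saturated power $\mathrm{pow}_k\,\mathcal D$ is the LC instance with variable set $X^k$, domains $\mathcal D_{x_1x_2\dots x_k}=\mathcal D_{x_1}\times\cdots\times\mathcal D_{x_k}$, and the following constraints, where first all constraints $x=\mathrm{id}(x)$ ($x\in X$) are added to $\mathcal D$: (1) for every $k$-tuple of constraints $x_i=\alpha_i(y_i)$, $i=1,\dots,k$,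 of $\mathcal D$, the constraint $x_1\dots x_k=(\alpha_1\times\cdots\times\alpha_k)(y_1\dots y_k)$; (2) for every $x_1\dots x_k\in X^k$ and every function $\sigma:[k]\to[k]$, the constraint $x_{\sigma(1)}\dots x_{\sigma(k)}=\sigma^*(x_1\dots x_k)$, where $\sigma^*(d_1\dots d_k)=d_{\sigma(1)}\dots d_{\sigma(k)}$. The minion $\mathcal Z_p$: $\mathcal Z_p^{(D)}=\{f:D\to\mathbb Z_p\mid\sum_{a\in D}f(a)=1\}$, and for $\alpha:D\to E$, $\mathcal Z_p^{(\alpha)}(f)(b)=\sum_{a\in\alpha^{ -1}(b)}f(a)$. The minion $\mathcal V_k\text{ - }\mathbb Z_p$: all computations are in the field $\mathbb Z_p$; for vectors in $\mathbb Z_p^N$ let $\mathfrak w(v_1,\dots,v_N)=v_1+\cdots+v_N$ and let $\odot$ denote the componentwise product. For a finite set $D$, $(\mathcal V_k\text{ - }\mathbb Z_p)^{(D)}$ is the set of triples $(V,\mathbf i,\mathbf v)$ where $V$ is a linear subspace of $\mathbb Z_p^N$ for some $N\in\mathbb N$, $\mathbf i\in V$, and $\mathbf v:D\to V$, such that: (i) $\mathbf i=(1,1,\dots,1)$ and $\mathfrak w(\mathbf i)=1$; (s) $\sum_{a\in D}\mathbf v(a)=\mathbf i$; (o) $\mathfrak w(\mathbf v(a)\odot\mathbf v(b)\odot\mathbf u_1\odot\cdots\odot\mathbf u_{k-2})=0$ for all $a\ne b$ in $D$ and all $\mathbf u_1,\dots,\mathbf u_{k-2}\in V$; (p) $\mathfrak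 w(\mathbf v(a)\odot\mathbf v(a)\odot\mathbf u_1\odot\cdots\odot\mathbf u_{k-2})=\mathfrak w(\mathbf v(a)\odot\mathbf u_1\odot\cdots\odot\mathbf u_{k-2})$ for all $a\in D$ and all $\mathbf u_1,\dots,\mathbf u_{k-2}\in V$. For $\alpha:D\to E$, $(\mathcal V_k\text{ - }\mathbb Z_p)^{(\alpha)}(V,\mathbf i,\mathbf v)=(V,\mathbf i,\mathbf v')$ with $\mathbf v'(b)=\sum_{a\in\alpha^{ -1}(b)}\mathbf v(a)$. -}

module Defs where

open import Algebra.Bundles using (CommutativeRing)
open import Algebra.Structures using (IsCommutativeRing)
open import Data.Bool.Base using (true; false; if_then_else_)
open import Data.Fin.Base as Fin using (Fin; toℕ)
import Data.Fin.Properties as Finₚ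
open import Data.List.Base as List using (List; []; _∷_; _++_; cartesianProductWith)
import Data.List.Relation.Unary.All as List using (All)
open import Data.List.Membership.Propositional using (_∈_)
open import Data.Nat.Base as ℕ using (ℕ; zero; suc; NonZero; _∸_; _%_)
open import Data.Nat.DivMod
  using (_mod_; m%n<n; m%n%n≡m%n; m<n⇒m%n≡m; n%n≡0; %-distribˡ-+; %-distribˡ-*)
import Data.Nat.Properties as ℕₚ
open import Data.Product.Base using (Σ; ∃; _×_; _,_; proj₁; proj₂)
open import Data.Product.Function.NonDependent.Propositional using (_×-↔_)
open import Data.Unit.Base using (⊤; tt)
open import Data.Vec.Base as Vec using (Vec; []; _∷_)
open import Data.Vec.Functional as Vector using (Vector)
open import Data.Vec.Relation.Unary.All as VecAll using (All; []; _∷_)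
open import Data.Vec.Relation.Unary.All.Properties using (lookup⁺; tabulate⁺)
open import Function.Base using (id; _∘_)
open import Function.Bundles using (_↔_; module Inverse; mk↔ₛ′)
open import Function.Construct.Composition using (_↔-∘_)
open import Function.Construct.Symmetry using (↔-sym)
open import Function.Properties.Inverse using (↔⇒↣)
open import Level using (Level; 0ℓ; _⊔_) renaming (suc to lsuc)
open import Relation.Binary.Bundles using (Setoid)
open import Relation.Binary.Construct.Closure.Equivalence using (EqClosure)
open import Relation.Binary.Definitions using (DecidableEquality)
open import Relation.Binary.PropositionalEquality
open import Relation.Nullary using (¬_; Dec; yes; no; does; contradiction)
open import Relation.Nullary.Decidable using (via-injection)
open import Relation.Unary using (Pred; _≐_)

private
  variable
    a c ℓ : Level

record FinSet : Set₁ where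
  field
    Carrier : Set
    size    : ℕ
    index   : Carrier ↔ Fin size

  open Inverse index public using (to; from; strictlyInverseˡ; strictlyInverseʳ)

  _≟_ : DecidableEquality Carrier
  _≟_ = via-injection (↔⇒↣ index) Finₚ._≟_

  elements : List Carrier
  elements = List.tabulate from

open FinSet using (elements) renaming (Carrier to ∣_∣)

private
  vec↔ : ∀ {A : Set} {n} → A ↔ Fin n → ∀ k → Vec A k ↔ Fin (n ℕ.^ k)
  vec↔ i zero    = ↔-sym Finₚ.1↔⊤ ↔-∘
    mk↔ₛ′ (λ _ → tt) (λ _ → []) (λ _ → refl) (λ { [] → refl })
  vec↔ i (suc k) = ↔-sym Finₚ.*↔× ↔-∘ ((i ×-↔ vec↔ i k) ↔-∘
    mk↔ₛ′ Vec.uncons (λ (x , xs) → x ∷ xs) (λ _ → refl) (λ { (_ ∷ _) → refl }))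

  allSize : ∀ {X : Set} → (X → FinSet) → ∀ {k} → Vec X k → ℕ
  allSize D []       = 1
  allSize D (x ∷ xs) = FinSet.size (D x) ℕ.* allSize D xs

  all↔ : ∀ {X : Set} (D : X → FinSet) {k} (xs : Vec X k) →
         All (∣_∣ ∘ D) xs ↔ Fin (allSize D xs)
  all↔ D []       = ↔-sym Finₚ.1↔⊤ ↔-∘
    mk↔ₛ′ (λ _ → tt) (λ _ → []) (λ _ → refl) (λ { [] → refl })
  all↔ D (x ∷ xs) = ↔-sym Finₚ.*↔× ↔-∘ ((FinSet.index (D x) ×-↔ all↔ D xs) ↔-∘
    mk↔ₛ′ VecAll.uncons (λ (d , ds) → d ∷ ds) (λ _ → refl) (λ { (_ ∷ _) → refl }))

Power : FinSet → ℕ → FinSet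
Power X k = record { Carrier = Vec ∣ X ∣ k ; index = vec↔ (FinSet.index X) k }

-- An inhabitant of All (∣_∣ ∘ D) (x₁ ∷ … ∷ xₖ ∷ []) is a tuple (d₁,…,dₖ)
-- with dᵢ in D xᵢ, so this is D x₁ × ⋯ × D xₖ.
Product : {X : Set} → (X → FinSet) → ∀ {k} → Vec X k → FinSet
Product D xs = record { Carrier = All (∣_∣ ∘ D) xs ; index = all↔ D xs }

-- The constraint lhs = map(rhs).
record Constraint {X : Set} (Dom : X → FinSet) : Set where
  constructor constraint
  field
    lhs rhs : X
    map     : ∣ Dom rhs ∣ → ∣ Dom lhs ∣

open Constraint

record LC : Set₁ where
  field
    Var         : FinSet
    Dom         : ∣ Var ∣ → FinSet
    constraints : List (Constraint Dom)

open LC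

Adjacent : (𝒟 : LC) → ∣ Var 𝒟 ∣ → ∣ Var 𝒟 ∣ → Set
Adjacent 𝒟 x y = ∃ λ e → e ∈ constraints 𝒟 × lhs e ≡ x × rhs e ≡ y

-- Any two vertices are joined by a (possibly empty) walk that may traverse
-- edges in both directions.
Connected : LC → Set
Connected 𝒟 = ∀ x y → EqClosure (Adjacent 𝒟) x y

tuples : {A : Set a} → List A → ∀ k → List (Vec A k)
tuples xs zero    = [] ∷ []
tuples xs (suc k) = cartesianProductWith _∷_ xs (tuples xs k)

withIdentities : (𝒟 : LC) → List (Constraint (Dom 𝒟))
withIdentities 𝒟 =
  constraints 𝒟 ++ List.map (λ x → constraint x x id) (elements (Var 𝒟))

module _ {X : Set} {Dom : X → FinSet} where

  productMap : ∀ {k} (es : Vec (Constraint Dom) k) →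
               All (∣_∣ ∘ Dom) (Vec.map rhs es) → All (∣_∣ ∘ Dom) (Vec.map lhs es)
  productMap []       []       = []
  productMap (e ∷ es) (d ∷ ds) = map e d ∷ productMap es ds

  productConstraint : ∀ {k} → Vec (Constraint Dom) k → Constraint (Product Dom {k})
  productConstraint es = constraint (Vec.map lhs es) (Vec.map rhs es) (productMap es)

  reindex : ∀ {A : Set} {k} → (Fin k → Fin k) → Vec A k → Vec A k
  reindex σ xs = Vec.tabulate (λ i → Vec.lookup xs (σ i))

  -- d₁…dₖ ↦ d_σ(1)…d_σ(k)
  _⋆ : ∀ {k} (σ : Fin k → Fin k) {xs : Vec X k} →
       All (∣_∣ ∘ Dom) xs → All (∣_∣ ∘ Dom) (reindex σ xs)
  (σ ⋆) ds = tabulate⁺ (λ i → lookup⁺ ds (σ i))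

  reindexConstraint : ∀ {k} → Vec X k → (Fin k → Fin k) → Constraint (Product Dom {k})
  reindexConstraint xs σ = constraint (reindex σ xs) xs (σ ⋆)

-- A function σ : [k] → [k] is enumerated as its table of values.
pow : ℕ → LC → LC
pow k 𝒟 = record
  { Var         = Power (Var 𝒟) k
  ; Dom         = Product (Dom 𝒟)
  ; constraints =
      List.map productConstraint (tuples (withIdentities 𝒟) k)
      ++ cartesianProductWith (λ xs σ → reindexConstraint xs (Vec.lookup σ))
           (tuples (elements (Var 𝒟)) k) (tuples (List.allFin k) k)
  }

-- Functors from finite sets to sets.  Sets are setoids, and functions
-- between finite sets are compared pointwise.
record Minion c ℓ : Set (lsuc (c ⊔ ℓ) ⊔ lsuc 0ℓ) where
  field
    Obj : FinSet → Setoid c ℓ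

  private
    module Obj D = Setoid (Obj D)

  field
    map      : ∀ D E → (∣ D ∣ → ∣ E ∣) → Obj.Carrier D → Obj.Carrier E
    map-cong : ∀ D E {α β : ∣ D ∣ → ∣ E ∣} {r s} → α ≗ β →
               Obj._≈_ D r s → Obj._≈_ E (map D E α r) (map D E β s)
    map-id   : ∀ D r → Obj._≈_ D (map D D id r) r
    map-∘    : ∀ D E F (α : ∣ D ∣ → ∣ E ∣) (β : ∣ E ∣ → ∣ F ∣) r →
               Obj._≈_ F (map D F (β ∘ α) r) (map E F β (map D E α r))

record Solution (𝒟 : LC) (ℛ : Minion c ℓ) : Set (c ⊔ ℓ) where
  open Minion ℛ renaming (map to ⟦_,_⟧)
  field
    value     : ∀ x → Setoid.Carrier (Obj (Dom 𝒟 x))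
    satisfies : List.All
      (λ e → Setoid._≈_ (Obj (Dom 𝒟 (lhs e))) (value (lhs e))
               (⟦ Dom 𝒟 (rhs e) , Dom 𝒟 (lhs e) ⟧ (map e) (value (rhs e))))
      (constraints 𝒟)

module _ (p : ℕ) .{{_ : NonZero p}} where

  private
    _⊕_ _⊗_ : Fin p → Fin p → Fin p
    x ⊕ y = (toℕ x ℕ.+ toℕ y) mod p
    x ⊗ y = (toℕ x ℕ.* toℕ y) mod p

    ⊖_ : Fin p → Fin p
    ⊖ x = (p ∸ toℕ x) mod p

    toℕ-mod : ∀ m → toℕ (m mod p) ≡ m % p
    toℕ-mod m = Finₚ.toℕ-fromℕ< (m%n<n m p)

    mod-cong : ∀ {m n} → m % p ≡ n % p → m mod p ≡ n mod p
    mod-cong {m} {n} eq =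
      Finₚ.toℕ-injective (trans (toℕ-mod m) (trans eq (sym (toℕ-mod n))))

    mod-toℕ : ∀ x → toℕ x mod p ≡ x
    mod-toℕ x =
      Finₚ.toℕ-injective (trans (toℕ-mod (toℕ x)) (m<n⇒m%n≡m (Finₚ.toℕ<n x)))

    mod-⊕ : ∀ m n → (m mod p) ⊕ (n mod p) ≡ (m ℕ.+ n) mod p
    mod-⊕ m n rewrite toℕ-mod m | toℕ-mod n = mod-cong (sym (%-distribˡ-+ m n p))

    mod-⊗ : ∀ m n → (m mod p) ⊗ (n mod p) ≡ (m ℕ.* n) mod p
    mod-⊗ m n rewrite toℕ-mod m | toℕ-mod n = mod-cong (sym (%-distribˡ-* m n p))

    mod-⊕ˡ : ∀ m y → (m mod p) ⊕ y ≡ (m ℕ.+ toℕ y) mod p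
    mod-⊕ˡ m y = trans (cong ((m mod p) ⊕_) (sym (mod-toℕ y))) (mod-⊕ m (toℕ y))

    mod-⊗ˡ : ∀ m y → (m mod p) ⊗ y ≡ (m ℕ.* toℕ y) mod p
    mod-⊗ˡ m y = trans (cong ((m mod p) ⊗_) (sym (mod-toℕ y))) (mod-⊗ m (toℕ y))

    ⊕-comm : ∀ x y → x ⊕ y ≡ y ⊕ x
    ⊕-comm x y = cong (_mod p) (ℕₚ.+-comm (toℕ x) (toℕ y))

    ⊗-comm : ∀ x y → x ⊗ y ≡ y ⊗ x
    ⊗-comm x y = cong (_mod p) (ℕₚ.*-comm (toℕ x) (toℕ y))

    ⊕-assoc : ∀ x y z → (x ⊕ y) ⊕ z ≡ x ⊕ (y ⊕ z)
    ⊕-assoc x y z = begin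
      (x ⊕ y) ⊕ z                        ≡⟨ mod-⊕ˡ _ z ⟩
      (toℕ x ℕ.+ toℕ y ℕ.+ toℕ z) mod p  ≡⟨ cong (_mod p) (trans (ℕₚ.+-assoc (toℕ x) _ _) (ℕₚ.+-comm (toℕ x) _)) ⟩
      (toℕ y ℕ.+ toℕ z ℕ.+ toℕ x) mod p  ≡⟨ mod-⊕ˡ _ x ⟨
      (y ⊕ z) ⊕ x                        ≡⟨ ⊕-comm (y ⊕ z) x ⟩
      x ⊕ (y ⊕ z)                        ∎
      where open ≡-Reasoning

    ⊗-assoc : ∀ x y z → (x ⊗ y) ⊗ z ≡ x ⊗ (y ⊗ z)
    ⊗-assoc x y z = begin
      (x ⊗ y) ⊗ z                        ≡⟨ mod-⊗ˡ _ z ⟩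
      (toℕ x ℕ.* toℕ y ℕ.* toℕ z) mod p  ≡⟨ cong (_mod p) (trans (ℕₚ.*-assoc (toℕ x) _ _) (ℕₚ.*-comm (toℕ x) _)) ⟩
      (toℕ y ℕ.* toℕ z ℕ.* toℕ x) mod p  ≡⟨ mod-⊗ˡ _ x ⟨
      (y ⊗ z) ⊗ x                        ≡⟨ ⊗-comm (y ⊗ z) x ⟩
      x ⊗ (y ⊗ z)                        ∎
      where open ≡-Reasoning

    ⊕-identityˡ : ∀ x → (0 mod p) ⊕ x ≡ x
    ⊕-identityˡ x = trans (mod-⊕ˡ 0 x) (mod-toℕ x)

    ⊗-identityˡ : ∀ x → (1 mod p) ⊗ x ≡ x
    ⊗-identityˡ x =
      trans (mod-⊗ˡ 1 x) (trans (cong (_mod p) (ℕₚ.*-identityˡ (toℕ x))) (mod-toℕ x))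

    ⊖-inverseˡ : ∀ x → (⊖ x) ⊕ x ≡ 0 mod p
    ⊖-inverseˡ x = trans (mod-⊕ˡ _ x) (trans
      (cong (_mod p) (ℕₚ.m∸n+n≡m (ℕₚ.<⇒≤ (Finₚ.toℕ<n x))))
      (mod-cong (trans (n%n≡0 p) (sym (m<n⇒m%n≡m (ℕ.>-nonZero⁻¹ p))))))

    ⊗-distribʳ-⊕ : ∀ x y z → (y ⊕ z) ⊗ x ≡ (y ⊗ x) ⊕ (z ⊗ x)
    ⊗-distribʳ-⊕ x y z = begin
      (y ⊕ z) ⊗ x                                    ≡⟨ mod-⊗ˡ _ x ⟩
      ((toℕ y ℕ.+ toℕ z) ℕ.* toℕ x) mod p            ≡⟨ cong (_mod p) (ℕₚ.*-distribʳ-+ (toℕ x) (toℕ y) (toℕ z)) ⟩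
      (toℕ y ℕ.* toℕ x ℕ.+ toℕ z ℕ.* toℕ x) mod p    ≡⟨ mod-⊕ _ _ ⟨
      (y ⊗ x) ⊕ (z ⊗ x)                              ∎
      where open ≡-Reasoning

    comm⇒idʳ : ∀ {_∙_ : Fin p → Fin p → Fin p} {e} → (∀ x y → x ∙ y ≡ y ∙ x) →
               (∀ x → e ∙ x ≡ x) → ∀ x → x ∙ e ≡ x
    comm⇒idʳ comm idˡ x = trans (comm x _) (idˡ x)

    isCommutativeRing :
      IsCommutativeRing _≡_ _⊕_ _⊗_ ⊖_ (0 mod p) (1 mod p)
    isCommutativeRing = record
      { isRing = record
        { +-isAbelianGroup = record
          { isGroup = record
            { isMonoid = record
              { isSemigroup = record
                { isMagma = record
                  { isEquivalence = isEquivalence ; ∙-cong = cong₂ _⊕_ }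
                ; assoc = ⊕-assoc }
              ; identity = ⊕-identityˡ , comm⇒idʳ ⊕-comm ⊕-identityˡ }
            ; inverse = ⊖-inverseˡ , λ x → trans (⊕-comm x _) (⊖-inverseˡ x)
            ; ⁻¹-cong = cong ⊖_ }
          ; comm = ⊕-comm }
        ; *-cong = cong₂ _⊗_
        ; *-assoc = ⊗-assoc
        ; *-identity = ⊗-identityˡ , comm⇒idʳ ⊗-comm ⊗-identityˡ
        ; distrib = (λ x y z → trans (⊗-comm x _) (trans (⊗-distribʳ-⊕ x y z)
                      (cong₂ _⊕_ (⊗-comm y x) (⊗-comm z x))))
                  , ⊗-distribʳ-⊕
        }
      ; *-comm = ⊗-comm
      }

  ℤ/ : CommutativeRing 0ℓ 0ℓ
  ℤ/ = record
    { Carrier = Fin p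
    ; _≈_ = _≡_
    ; _+_ = _⊕_
    ; _*_ = _⊗_
    ; -_ = ⊖_
    ; 0# = 0 mod p
    ; 1# = 1 mod p
    ; isCommutativeRing = isCommutativeRing
    }

module _ (p : ℕ) .{{_ : NonZero p}} where

  open CommutativeRing (ℤ/ p) using
    ( 0#; 1#; _+_; _*_; semiring; +-commutativeMonoid; +-identityʳ
    ; *-assoc; *-comm; zeroˡ)
    renaming (Carrier to ℤₚ)
  open import Algebra.Properties.Semiring.Sum semiring
    using (sum; sum-cong-≗; sum-replicate-zero; *-distribʳ-sum)
  open import Algebra.Properties.CommutativeMonoid.Sum +-commutativeMonoid
    using (sum-remove; ∑-comm)

  ∑ : (D : FinSet) → (∣ D ∣ → ℤₚ) → ℤₚ
  ∑ D f = sum (λ j → f (FinSet.from D j))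

  -- Σ_{a ∈ α⁻¹(b)} f(a)
  fibreSum : (D E : FinSet) → (∣ D ∣ → ∣ E ∣) → (∣ D ∣ → ℤₚ) → ∣ E ∣ → ℤₚ
  fibreSum D E α f b = ∑ D λ a → if does (α a E.≟ b) then f a else 0#
    where module E = FinSet E

  if-elim : {A : Set} (A? : Dec A) {x y z : ℤₚ} → (A → x ≡ z) → (¬ A → y ≡ z) →
            (if does A? then x else y) ≡ z
  if-elim (yes a) x≡z y≡z = x≡z a
  if-elim (no ¬a) x≡z y≡z = y≡z ¬a

  if-congˡ : {A : Set} (A? : Dec A) {x x′ y : ℤₚ} → (A → x ≡ x′) →
             (if does A? then x else y) ≡ (if does A? then x′ else y)
  if-congˡ (yes a) x≡x′ = x≡x′ a
  if-congˡ (no _)  x≡x′ = refl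

  ∑-cong : ∀ D {f g} → f ≗ g → ∑ D f ≡ ∑ D g
  ∑-cong D eq = sum-cong-≗ (λ j → eq (FinSet.from D j))

  ∑-zero : ∀ D {f} → (∀ a → f a ≡ 0#) → ∑ D f ≡ 0#
  ∑-zero D eq = trans (∑-cong D eq) (sum-replicate-zero (FinSet.size D))

  ∑-swap : ∀ D E (f : ∣ D ∣ → ∣ E ∣ → ℤₚ) →
           ∑ D (λ a → ∑ E (f a)) ≡ ∑ E (λ b → ∑ D (λ a → f a b))
  ∑-swap D E f = ∑-comm (λ i j → f (FinSet.from D i) (FinSet.from E j))

  sum-single : ∀ {n} (f : Vector ℤₚ n) j → (∀ i → i ≢ j → f i ≡ 0#) → sum f ≡ f j
  sum-single {suc n} f j off = trans (sum-remove {i = j} f) (trans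
    (cong (f j +_) (trans
      (sum-cong-≗ (λ i → off (Fin.punchIn j i) (Finₚ.punchInᵢ≢i j i)))
      (sum-replicate-zero n)))
    (+-identityʳ (f j)))

  ∑-single : ∀ D (f : ∣ D ∣ → ℤₚ) d → (∀ a → a ≢ d → f a ≡ 0#) → ∑ D f ≡ f d
  ∑-single D f d off = trans
    (sum-single (f ∘ D.from) (D.to d)
      (λ i i≢ → off (D.from i)
        (λ eq → i≢ (trans (sym (D.strictlyInverseˡ i)) (cong D.to eq)))))
    (cong f (D.strictlyInverseʳ d))
    where module D = FinSet D

  ∑-δ : ∀ D (f : ∣ D ∣ → ℤₚ) d →
        ∑ D (λ a → if does (FinSet._≟_ D d a) then f a else 0#) ≡ f d
  ∑-δ D f d = trans (∑-single D _ d off) on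
    where
    module D = FinSet D
    off : ∀ a → a ≢ d → (if does (d D.≟ a) then f a else 0#) ≡ 0#
    off a a≢d = if-elim (d D.≟ a) (λ d≡a → contradiction (sym d≡a) a≢d) (λ _ → refl)
    on : (if does (d D.≟ d) then f d else 0#) ≡ f d
    on = if-elim (d D.≟ d) (λ _ → refl) (λ d≢d → contradiction refl d≢d)

  fibreSum-cong : ∀ D E {α β} {f g} → α ≗ β → f ≗ g →
                  fibreSum D E α f ≗ fibreSum D E β g
  fibreSum-cong D E α≗β f≗g b = ∑-cong D λ a →
    cong₂ (λ x y → if does (FinSet._≟_ E x b) then y else 0#) (α≗β a) (f≗g a)

  fibreSum-id : ∀ D f → fibreSum D D id f ≗ f
  fibreSum-id D f b = trans (∑-single D _ b off) on
    where
    module D = FinSet D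
    off : ∀ a → a ≢ b → (if does (a D.≟ b) then f a else 0#) ≡ 0#
    off a a≢b = if-elim (a D.≟ b) (λ a≡b → contradiction a≡b a≢b) (λ _ → refl)
    on : (if does (b D.≟ b) then f b else 0#) ≡ f b
    on = if-elim (b D.≟ b) (λ _ → refl) (λ b≢b → contradiction refl b≢b)

  if-∑ : ∀ t D f → (if t then ∑ D f else 0#) ≡ ∑ D (λ a → if t then f a else 0#)
  if-∑ true  D f = refl
  if-∑ false D f = sym (∑-zero D (λ _ → refl))

  if-if : ∀ s t (x : ℤₚ) → (if s then (if t then x else 0#) else 0#)
                         ≡ (if t then (if s then x else 0#) else 0#)
  if-if true  t x = refl
  if-if false true  x = refl
  if-if false false x = refl

  if-* : ∀ t (x y : ℤₚ) → (if t then x else 0#) * y ≡ (if t then x * y else 0#)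
  if-* true  x y = refl
  if-* false x y = zeroˡ y

  fibreSum-∘ : ∀ D E F (α : ∣ D ∣ → ∣ E ∣) (β : ∣ E ∣ → ∣ F ∣) f →
               fibreSum D F (β ∘ α) f ≗ fibreSum E F β (fibreSum D E α f)
  fibreSum-∘ D E F α β f x = sym (begin
    ∑ E (λ b → if β∈ b then ∑ D (λ a → if α∈ a b then f a else 0#) else 0#)
      ≡⟨ ∑-cong E (λ b → if-∑ (β∈ b) D (λ a → if α∈ a b then f a else 0#)) ⟩
    ∑ E (λ b → ∑ D (λ a → if β∈ b then (if α∈ a b then f a else 0#) else 0#))
      ≡⟨ ∑-swap E D (λ b a → if β∈ b then (if α∈ a b then f a else 0#) else 0#) ⟩
    ∑ D (λ a → ∑ E (λ b → if β∈ b then (if α∈ a b then f a else 0#) else 0#))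
      ≡⟨ ∑-cong D (λ a → ∑-cong E (λ b → if-if (β∈ b) (α∈ a b) (f a))) ⟩
    ∑ D (λ a → ∑ E (λ b → if α∈ a b then (if β∈ b then f a else 0#) else 0#))
      ≡⟨ ∑-cong D (λ a → ∑-δ E (λ b → if β∈ b then f a else 0#) (α a)) ⟩
    ∑ D (λ a → if β∈ (α a) then f a else 0#) ∎)
    where
    open ≡-Reasoning
    β∈ = λ b → does (FinSet._≟_ F (β b) x)
    α∈ = λ a b → does (FinSet._≟_ E (α a) b)

  ∑-fibreSum : ∀ D E α f → ∑ E (fibreSum D E α f) ≡ ∑ D f
  ∑-fibreSum D E α f =
    trans (∑-swap E D (λ b a → if does (FinSet._≟_ E (α a) b) then f a else 0#))
          (∑-cong D (λ a → ∑-δ E (λ _ → f a) (α a)))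

  𝒵 : Minion 0ℓ 0ℓ
  𝒵 = record
    { Obj = λ D → record
      { Carrier       = Σ (∣ D ∣ → ℤₚ) λ f → ∑ D f ≡ 1#
      ; _≈_           = λ (f , _) (g , _) → f ≗ g
      ; isEquivalence = record
        { refl  = λ _ → refl
        ; sym   = λ eq a → sym (eq a)
        ; trans = λ eq eq′ a → trans (eq a) (eq′ a)
        }
      }
    ; map      = λ D E α (f , f-sum) →
        fibreSum D E α f , trans (∑-fibreSum D E α f) f-sum
    ; map-cong = λ D E → fibreSum-cong D E
    ; map-id   = λ D (f , _) → fibreSum-id D f
    ; map-∘    = λ D E F α β (f , _) → fibreSum-∘ D E F α β f
    }

  infixr 7 _⊙_

  _⊙_ : ∀ {N} → Vector ℤₚ N → Vector ℤₚ N → Vector ℤₚ N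
  _⊙_ = Vector.zipWith _*_

  𝟙 : ∀ {N} → Vector ℤₚ N
  𝟙 _ = 1#

  ⨀ : ∀ {N m} → Vec (Vector ℤₚ N) m → Vector ℤₚ N
  ⨀ = Vec.foldr′ _⊙_ 𝟙

  𝔴 : ∀ {N} → Vector ℤₚ N → ℤₚ
  𝔴 = sum

  -- Vectors are functions, so they are compared pointwise and membership has
  -- to be invariant under that equality.
  record Subspace (N : ℕ) : Set₁ where
    field
      member   : Pred (Vector ℤₚ N) 0ℓ
      ≗-resp   : ∀ {u w} → u ≗ w → member u → member w
      0-closed : member (λ _ → 0#)
      +-closed : ∀ {u w} → member u → member w → member (λ j → u j + w j)
      *-closed : ∀ x {u} → member u → member (λ j → x * u j)

  open Subspace

  record Triple (D : FinSet) : Set₁ where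
    constructor triple
    field
      {N} : ℕ
      V   : Subspace N
      i   : Vector ℤₚ N
      v   : ∣ D ∣ → Vector ℤₚ N

  record IsElement (k : ℕ) {D : FinSet} (t : Triple D) : Set where
    open Triple t
    field
      i∈V  : member V i
      v∈V  : ∀ a → member V (v a)
      ax-i : i ≗ 𝟙 × 𝔴 i ≡ 1#
      ax-s : ∀ j → ∑ D (λ a → v a j) ≡ i j
      ax-o : ∀ {a b} → a ≢ b → (us : Vec (Vector ℤₚ N) (k ∸ 2)) →
             All (member V) us → 𝔴 (v a ⊙ v b ⊙ ⨀ us) ≡ 0#
      ax-p : ∀ a (us : Vec (Vector ℤₚ N) (k ∸ 2)) →
             All (member V) us → 𝔴 (v a ⊙ v a ⊙ ⨀ us) ≡ 𝔴 (v a ⊙ ⨀ us)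

  -- Equal triples have the same N, and subspaces are compared extensionally.
  data _≈ₜ_ {D : FinSet} : Triple D → Triple D → Set₁ where
    same : ∀ {N} {V V′ : Subspace N} {i i′ v v′} →
           member V ≐ member V′ → i ≗ i′ → (∀ a → v a ≗ v′ a) →
           triple V i v ≈ₜ triple V′ i′ v′

  mapTriple : ∀ D E → (∣ D ∣ → ∣ E ∣) → Triple D → Triple E
  mapTriple D E α (triple V i v) =
    triple V i (λ b j → fibreSum D E α (λ a → v a j) b)

  member-sum : ∀ {N} (V : Subspace N) {n} (f : Fin n → Vector ℤₚ N) →
               (∀ i → member V (f i)) → member V (λ j → sum (λ i → f i j))
  member-sum V {zero}  f f∈V = 0-closed V
  member-sum V {suc n} f f∈V =
    +-closed V (f∈V Fin.zero) (member-sum V (f ∘ Fin.suc) (f∈V ∘ Fin.suc))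

  member-if : ∀ {N} (V : Subspace N) t {u} → member V u →
              member V (λ j → if t then u j else 0#)
  member-if V true  u∈V = u∈V
  member-if V false u∈V = 0-closed V

  𝔴-swap : ∀ {N} (x y z : Vector ℤₚ N) → 𝔴 (x ⊙ y ⊙ z) ≡ 𝔴 (y ⊙ x ⊙ z)
  𝔴-swap x y z = sum-cong-≗ λ j → begin
    x j * (y j * z j) ≡⟨ *-assoc (x j) (y j) (z j) ⟨
    (x j * y j) * z j ≡⟨ cong (_* z j) (*-comm (x j) (y j)) ⟩
    (y j * x j) * z j ≡⟨ *-assoc (y j) (x j) (z j) ⟩
    y j * (x j * z j) ∎
    where open ≡-Reasoning

  module _ (D E : FinSet) (α : ∣ D ∣ → ∣ E ∣) {N : ℕ} (v : ∣ D ∣ → Vector ℤₚ N) where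

    private
      module D = FinSet D
      module E = FinSet E

    v′ : ∣ E ∣ → Vector ℤₚ N
    v′ b j = fibreSum D E α (λ a → v a j) b

    𝔴-fibre : ∀ b y → 𝔴 (v′ b ⊙ y) ≡
              ∑ D (λ a → if does (α a E.≟ b) then 𝔴 (v a ⊙ y) else 0#)
    𝔴-fibre b y = begin
      sum (λ j → v′ b j * y j)
        ≡⟨ sum-cong-≗ (λ j → trans (*-distribʳ-sum (y j) (λ n → term (D.from n) j))
             (∑-cong D (λ a → if-* (does (α a E.≟ b)) (v a j) (y j)))) ⟩
      sum (λ j → ∑ D (λ a → if does (α a E.≟ b) then v a j * y j else 0#))
        ≡⟨ ∑-comm (λ j n → if does (α (D.from n) E.≟ b) then v (D.from n) j * y j else 0#) ⟩
      ∑ D (λ a → sum (λ j → if does (α a E.≟ b) then v a j * y j else 0#))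
        ≡⟨ ∑-cong D (λ a → pull (does (α a E.≟ b)) (λ j → v a j * y j)) ⟩
      ∑ D (λ a → if does (α a E.≟ b) then 𝔴 (v a ⊙ y) else 0#) ∎
      where
      open ≡-Reasoning
      term = λ a j → if does (α a E.≟ b) then v a j else 0#
      pull : ∀ t (f : Vector ℤₚ N) →
             sum (λ j → if t then f j else 0#) ≡ (if t then sum f else 0#)
      pull true  f = refl
      pull false f = sum-replicate-zero N

    𝔴-fibre₂ : ∀ b b′ z → 𝔴 (v′ b ⊙ v′ b′ ⊙ z) ≡
      ∑ D (λ a → if does (α a E.≟ b) then
        ∑ D (λ a′ → if does (α a′ E.≟ b′) then 𝔴 (v a′ ⊙ v a ⊙ z) else 0#) else 0#)
    𝔴-fibre₂ b b′ z = trans (𝔴-fibre b (v′ b′ ⊙ z)) (∑-cong D λ a →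
      cong (λ x → if does (α a E.≟ b) then x else 0#)
        (trans (𝔴-swap (v a) (v′ b′) z) (𝔴-fibre b′ (v a ⊙ z))))

    fibre-o : ∀ {z} → (∀ {a a′} → a ≢ a′ → 𝔴 (v a ⊙ v a′ ⊙ z) ≡ 0#) →
              ∀ {b b′} → b ≢ b′ → 𝔴 (v′ b ⊙ v′ b′ ⊙ z) ≡ 0#
    fibre-o {z} o {b} {b′} b≢b′ = trans (𝔴-fibre₂ b b′ z) (∑-zero D outer)
      where
      inner : ∀ a → α a ≡ b → ∀ a′ →
              (if does (α a′ E.≟ b′) then 𝔴 (v a′ ⊙ v a ⊙ z) else 0#) ≡ 0#
      inner a αa≡b a′ = if-elim (α a′ E.≟ b′)
        (λ αa′≡b′ → o λ a′≡a →
          b≢b′ (trans (sym αa≡b) (trans (cong α (sym a′≡a)) αa′≡b′)))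
        (λ _ → refl)
      outer : ∀ a → (if does (α a E.≟ b) then
        ∑ D (λ a′ → if does (α a′ E.≟ b′) then 𝔴 (v a′ ⊙ v a ⊙ z) else 0#) else 0#) ≡ 0#
      outer a = if-elim (α a E.≟ b) (λ αa≡b → ∑-zero D (inner a αa≡b)) (λ _ → refl)

    fibre-p : ∀ {z} → (∀ {a a′} → a ≢ a′ → 𝔴 (v a ⊙ v a′ ⊙ z) ≡ 0#) →
              (∀ a → 𝔴 (v a ⊙ v a ⊙ z) ≡ 𝔴 (v a ⊙ z)) →
              ∀ b → 𝔴 (v′ b ⊙ v′ b ⊙ z) ≡ 𝔴 (v′ b ⊙ z)
    fibre-p {z} o p b =
      trans (𝔴-fibre₂ b b z) (trans (∑-cong D outer) (sym (𝔴-fibre b z)))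
      where
      off : ∀ a a′ → a′ ≢ a →
            (if does (α a′ E.≟ b) then 𝔴 (v a′ ⊙ v a ⊙ z) else 0#) ≡ 0#
      off a a′ a′≢a = if-elim (α a′ E.≟ b) (λ _ → o a′≢a) (λ _ → refl)
      on : ∀ a → α a ≡ b →
           (if does (α a E.≟ b) then 𝔴 (v a ⊙ v a ⊙ z) else 0#) ≡ 𝔴 (v a ⊙ z)
      on a αa≡b = if-elim (α a E.≟ b) (λ _ → p a) (λ αa≢b → contradiction αa≡b αa≢b)
      outer : ∀ a → (if does (α a E.≟ b) then
        ∑ D (λ a′ → if does (α a′ E.≟ b) then 𝔴 (v a′ ⊙ v a ⊙ z) else 0#) else 0#)
        ≡ (if does (α a E.≟ b) then 𝔴 (v a ⊙ z) else 0#)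
      outer a = if-congˡ (α a E.≟ b) λ αa≡b →
        trans (∑-single D _ a (off a)) (on a αa≡b)

  mapTriple-isElement : ∀ k D E α t → IsElement k t → IsElement k (mapTriple D E α t)
  mapTriple-isElement k D E α (triple V i v) el = record
    { i∈V  = i∈V
    ; v∈V  = λ b → member-sum V _ λ n → member-if V
               (does (FinSet._≟_ E (α (FinSet.from D n)) b)) (v∈V (FinSet.from D n))
    ; ax-i = ax-i
    ; ax-s = λ j → trans (∑-fibreSum D E α (λ a → v a j)) (ax-s j)
    ; ax-o = λ b≢b′ us us∈V → fibre-o D E α v (λ a≢a′ → ax-o a≢a′ us us∈V) b≢b′
    ; ax-p = λ b us us∈V → fibre-p D E α v
               (λ a≢a′ → ax-o a≢a′ us us∈V) (λ a → ax-p a us us∈V) b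
    }
    where open IsElement el

  module _ {D : FinSet} where

    ≈ₜ-refl : {t : Triple D} → t ≈ₜ t
    ≈ₜ-refl = same (id , id) (λ _ → refl) (λ _ _ → refl)

    ≈ₜ-sym : {s t : Triple D} → s ≈ₜ t → t ≈ₜ s
    ≈ₜ-sym (same (f , g) i≗ v≗) =
      same (g , f) (λ j → sym (i≗ j)) (λ a j → sym (v≗ a j))

    ≈ₜ-trans : {s t u : Triple D} → s ≈ₜ t → t ≈ₜ u → s ≈ₜ u
    ≈ₜ-trans (same (f , g) i≗ v≗) (same (f′ , g′) i≗′ v≗′) =
      same ((λ x → f′ (f x)) , (λ x → g (g′ x)))
           (λ j → trans (i≗ j) (i≗′ j)) (λ a j → trans (v≗ a j) (v≗′ a j))

  mapTriple-cong : ∀ D E {α β : ∣ D ∣ → ∣ E ∣} {s t} → α ≗ β → s ≈ₜ t →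
                   mapTriple D E α s ≈ₜ mapTriple D E β t
  mapTriple-cong D E α≗β (same V≐ i≗ v≗) =
    same V≐ i≗ (λ b j → fibreSum-cong D E α≗β (λ a → v≗ a j) b)

  𝒱 : ℕ → Minion (lsuc 0ℓ) (lsuc 0ℓ)
  𝒱 k = record
    { Obj = λ D → record
      { Carrier       = Σ (Triple D) (IsElement k)
      ; _≈_           = λ (s , _) (t , _) → s ≈ₜ t
      ; isEquivalence = record
        { refl = ≈ₜ-refl ; sym = ≈ₜ-sym ; trans = ≈ₜ-trans }
      }
    ; map      = λ D E α (t , el) →
        mapTriple D E α t , mapTriple-isElement k D E α t el
    ; map-cong = λ D E → mapTriple-cong D E
    ; map-id   = λ D (triple V i v , _) →
        same (id , id) (λ _ → refl) (λ b j → fibreSum-id D (λ a → v a j) b)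
    ; map-∘    = λ D E F α β (triple V i v , _) →
        same (id , id) (λ _ → refl) (λ b j → fibreSum-∘ D E F α β (λ a → v a j) b)
    }

{-# OPTIONS --safe #-}

-- Both kinds of solutions are encoded by one function Ψ on lists of at most k
-- pairs (x , d), d in the domain of x: in terms of vectors, Ψ is 𝔴 of the
-- product of the vectors of the pairs; in terms of the power, it is the value
-- at a k-tuple with the same set of entries.
--
-- From vectors to the power only the constraints given by a reindexing σ need
-- an argument: the entries are grouped by the fibres of σ, and within a fibre
-- (o) and (p) collapse the product to a single factor.  Connectedness makes
-- the space V and the vector i the same for all variables.
--
-- Conversely, Möbius inversion yields a list of 0/1-points, one coordinate per
-- pair, whose coordinate vectors have the prescribed 𝔴 of products.  They
-- satisfy the linear relations required by (s) and by the constraints only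
-- weakly, that is, after multiplication with fewer than k further vectors.
-- Gaussian elimination on the relations gives a linear projection π that
-- annihilates them and changes every coordinate by a weak relation only, so
-- the images of the coordinate vectors under π satisfy the relations exactly
-- and have the same 𝔴 of products.
module Submission where

open import Defs
open import Algebra.Bundles using (CommutativeRing)
import Algebra.Properties.Ring as RingProperties
open import Algebra.Structures using (IsCommutativeRing)
open import Data.Bool.Base using (Bool; true; false; if_then_else_)
open import Data.Fin.Base as Fin using (Fin; zero; suc; toℕ)
import Data.Fin.Properties as Finₚ
open import Data.List.Base as List using (List; []; _∷_; _++_)
open import Data.List.Membership.Propositional using (_∈_)
import Data.List.Membership.Propositional.Properties as ∈ₚ
import Data.List.Properties as Listₚ
open import Data.List.Relation.Binary.Subset.Propositional using (_⊆_)
import Data.List.Relation.Binary.Subset.Propositional.Properties as ⊆ₚ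
open import Data.List.Relation.Unary.All as ListAll using ([]; _∷_)
import Data.List.Relation.Unary.All.Properties as ListAllₚ
open import Data.List.Relation.Unary.Any as ListAny using (here; there)
open import Data.List.Relation.Unary.Any.Properties using (lookup-index)
open import Data.Nat.Base as ℕ using (ℕ; zero; suc; NonZero; _≤_; _<_; z≤n; s≤s; _%_)
open import Data.Nat.Coprimality using (prime⇒coprime; coprime-Bézout)
open import Data.Nat.DivMod using (_mod_; m%n<n; m<n⇒m%n≡m; [m+kn]%n≡m%n; %-distribˡ-+; %-distribˡ-*)
open import Data.Nat.GCD using (module Bézout)
open import Data.Nat.Primality using (Prime; prime⇒nonZero)
import Data.Nat.Properties as ℕₚ
open import Data.Product.Base using (Σ; ∃; _×_; _,_; proj₁; proj₂)
import Data.Product.Properties as Productₚ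
open import Data.Sum.Base using (_⊎_; inj₁; inj₂)
open import Data.Vec.Base as Vec using (Vec; []; _∷_)
open import Data.Vec.Functional using (Vector)
import Data.Vec.Properties as Vecₚ
open import Data.Vec.Relation.Unary.All as VecAll using (All; []; _∷_)
open import Data.Vec.Relation.Unary.All.Properties using (lookup⁺; tabulate⁺)
open import Function.Base using (id; _∘_)
open import Function.Bundles using (_⇔_; mk⇔; module Inverse)
open import Level using (0ℓ)
open import Relation.Binary.Construct.Closure.Equivalence using (EqClosure)
open import Relation.Binary.Construct.Closure.ReflexiveTransitive using (ε; _◅_)
open import Relation.Binary.Construct.Closure.Symmetric using (fwd; bwd)
open import Relation.Binary.Definitions using (DecidableEquality)
open import Relation.Binary.PropositionalEquality
open import Relation.Nullary using (¬_; Dec; yes; no; does; contradiction; ¬?)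
open import Relation.Nullary.Decidable using (decidable-stable)

open FinSet using (elements) renaming (Carrier to ∣_∣)
open Constraint using (lhs; rhs) renaming (map to apply)
open LC using (Var; Dom; constraints)

-- A solution in the vector minion must satisfy (s) and the constraints as equations between
-- vectors, while the moments control 𝔴 only for products of at most k factors. The weak relations
-- cannot be divided out, because 𝔴 and the componentwise product live on the ambient space; so new
-- vectors are chosen in the span of the old ones and 1. Replacing one factor by its image under π
-- changes it by a relation that vanishes against the at most k - 1 other factors, so every
-- prescribed 𝔴 survives. Equation (s) is affine. Hence there is an extra coordinate for the
-- constant 1, which π must fix; the value 1 of Ψ at the empty list guarantees that no nonzero
-- constant becomes a consequence of the relations. Möbius inversion produces weights in the field,
-- whereas 𝔴 counts points without weights; in a prime field a weight can be realised as a
-- multiplicity. That Ψ depends only on the set of entries comes from non-injective reindexings: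
-- overwriting one slot by another forces the value at a tuple with two different entries for one
-- variable to vanish.

-- multipleOf1 says that the field has no proper subfield.
record PrimeField : Set₁ where
  infix  4 _≟_
  field
    F                 : Set
    _+_ _*_           : F → F → F
    -_                : F → F
    0# 1#             : F
    isCommutativeRing : IsCommutativeRing _≡_ _+_ _*_ -_ 0# 1#
    _≟_               : DecidableEquality F
    inverse           : ∀ x → x ≢ 0# → ∃ λ y → y * x ≡ 1#
    multipleOf1       : ∀ x → ∃ λ n → List.foldr _+_ 0# (List.replicate n 1#) ≡ x

  commutativeRing : CommutativeRing 0ℓ 0ℓ
  commutativeRing = record { isCommutativeRing = isCommutativeRing }

-- Vectors over a field and the pairing of coefficient vectors with vectors.

module Linear (𝔽 : PrimeField) where

  open PrimeField 𝔽 public using (F; _≟_; inverse; multipleOf1; commutativeRing)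
  open CommutativeRing commutativeRing public using
    ( 0#; 1#; _+_; _*_; -_; +-group; ring; semiring; *-commutativeSemigroup; +-commutativeMonoid
    ; +-assoc; +-comm; +-identityˡ; +-identityʳ; -‿inverseˡ; -‿inverseʳ
    ; *-assoc; *-comm; *-identityˡ; *-identityʳ; distribˡ; distribʳ; zeroˡ; zeroʳ)
  open import Algebra.Properties.Semiring.Sum semiring public
    using (sum; sum-cong-≗; sum-replicate-zero; *-distribˡ-sum; *-distribʳ-sum)
  open import Algebra.Properties.CommutativeMonoid.Sum +-commutativeMonoid public
    using (∑-comm; ∑-distrib-+; sum-remove)
  open RingProperties ring public using (-1*x≈-x; -‿distribˡ-*)
  open import Algebra.Properties.Group +-group public
    using () renaming (x≈y⇒x∙y⁻¹≈ε to x≈y⇒x-y≈0; x∙y⁻¹≈ε⇒x≈y to x-y≈0⇒x≈y)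
  open import Algebra.Properties.CommutativeSemigroup *-commutativeSemigroup public
    using (x∙yz≈y∙xz; xy∙z≈y∙xz)

  infixr 7 _∙_

  _∙_ : ∀ {N} → Vector F N → Vector F N → Vector F N
  (u ∙ w) j = u j * w j

  sum-zero : ∀ {n} {f : Vector F n} → (∀ i → f i ≡ 0#) → sum f ≡ 0#
  sum-zero {n} f≡0 = trans (sum-cong-≗ f≡0) (sum-replicate-zero n)

  sum-only : ∀ {n} (f : Vector F n) j → (∀ i → i ≢ j → f i ≡ 0#) → sum f ≡ f j
  sum-only {suc n} f j off = trans (sum-remove {i = j} f) (trans
    (cong (f j +_) (sum-zero λ i → off (Fin.punchIn j i) (Finₚ.punchInᵢ≢i j i)))
    (+-identityʳ (f j)))

  if-yes : ∀ {A : Set} (A? : Dec A) {x y : F} → A → (if does A? then x else y) ≡ x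
  if-yes (yes _) _ = refl
  if-yes (no ¬a) a = contradiction a ¬a

  if-no : ∀ {A : Set} (A? : Dec A) {x y : F} → ¬ A → (if does A? then x else y) ≡ y
  if-no (yes a) ¬a = contradiction a ¬a
  if-no (no _)  _  = refl

  δ : ∀ {n} → Fin n → Vector F n
  δ s q = if does (s Finₚ.≟ q) then 1# else 0#

  infix 8 _·_

  _·_ : ∀ {n} → Vector F n → Vector F n → F
  r · E = sum (r ∙ E)

  ·-congˡ : ∀ {n} {r r′ : Vector F n} E → r ≗ r′ → r · E ≡ r′ · E
  ·-congˡ E eq = sum-cong-≗ λ q → cong (_* E q) (eq q)

  ·-congʳ : ∀ {n} (r : Vector F n) {E E′} → E ≗ E′ → r · E ≡ r · E′
  ·-congʳ r eq = sum-cong-≗ λ q → cong (r q *_) (eq q)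

  ·-zeroˡ : ∀ {n} {r : Vector F n} E → (∀ q → r q ≡ 0#) → r · E ≡ 0#
  ·-zeroˡ {n} E r≡0 = trans (sum-cong-≗ λ q → trans (cong (_* E q) (r≡0 q)) (zeroˡ (E q))) (sum-replicate-zero n)

  δ-· : ∀ {n} (s : Fin n) E → δ s · E ≡ E s
  δ-· s E = trans (sum-only _ s off) on
    where
    off : ∀ q → q ≢ s → δ s q * E q ≡ 0#
    off q q≢s = trans (cong (_* E q) (if-no (s Finₚ.≟ q) (λ s≡q → q≢s (sym s≡q))))
                      (zeroˡ (E q))
    on : δ s s * E s ≡ E s
    on = trans (cong (_* E s) (if-yes (s Finₚ.≟ s) refl))
               (*-identityˡ (E s))

  ·-+ˡ : ∀ {n} (r r′ E : Vector F n) → (λ q → r q + r′ q) · E ≡ r · E + r′ · E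
  ·-+ˡ r r′ E = trans (sum-cong-≗ λ q → distribʳ (E q) (r q) (r′ q)) (∑-distrib-+ (r ∙ E) (r′ ∙ E))

  ·-+ʳ : ∀ {n} (r E E′ : Vector F n) → r · (λ q → E q + E′ q) ≡ r · E + r · E′
  ·-+ʳ r E E′ = trans (sum-cong-≗ λ q → distribˡ (r q) (E q) (E′ q)) (∑-distrib-+ (r ∙ E) (r ∙ E′))

  ·-*ˡ : ∀ {n} x (r E : Vector F n) → (λ q → x * r q) · E ≡ x * (r · E)
  ·-*ˡ x r E = trans (sum-cong-≗ λ q → *-assoc x (r q) (E q)) (sym (*-distribˡ-sum x (r ∙ E)))

  ·-*ʳ : ∀ {n} x (r E : Vector F n) → r · (λ q → E q * x) ≡ (r · E) * x
  ·-*ʳ x r E = trans (sum-cong-≗ λ q → sym (*-assoc (r q) (E q) x)) (sym (*-distribʳ-sum x (r ∙ E)))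

  ·-assoc : ∀ {m n} (r : Vector F m) (A : Fin m → Vector F n) E →
            r · (λ s → A s · E) ≡ (λ q → r · (λ s → A s q)) · E
  ·-assoc r A E = begin
    sum (λ s → r s * (A s · E))                 ≡⟨ sum-cong-≗ (λ s → *-distribˡ-sum (r s) (A s ∙ E)) ⟩
    sum (λ s → sum λ q → r s * (A s q * E q))   ≡⟨ ∑-comm (λ s q → r s * (A s q * E q)) ⟩
    sum (λ q → sum λ s → r s * (A s q * E q))   ≡⟨ sum-cong-≗ (λ q → ·-*ʳ (E q) r (λ s → A s q)) ⟩
    (λ q → r · (λ s → A s q)) · E               ∎
    where open ≡-Reasoning

-- Gaussian elimination relative to a set of test vectors.

module Elimination (𝔽 : PrimeField) where

  open Linear 𝔽
  open ≡-Reasoning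

  -- Coordinate zero stands for the constant 1.
  module _ {n} (Test : Vector F (suc n) → Set) (E₀ : Vector F (suc n))
           (E₀-test : Test E₀) (E₀-zero : E₀ zero ≡ 1#) where

    Annihilated : Vector F (suc n) → Set
    Annihilated r = ∀ {E} → Test E → r · E ≡ 0#

    -- Row `π s` writes the new coordinate `s` as a combination of the old ones. Agreement with the
    -- identity is asked only against test vectors, since the relations hold only there.
    record Projection (R : List (Vector F (suc n))) : Set where
      field
        π      : Fin (suc n) → Vector F (suc n)
        π-test : ∀ s {E} → Test E → π s · E ≡ E s
        π-zero : π zero ≗ δ zero
        π-kill : ListAll.All (λ r → ∀ q → r · (λ s → π s q) ≡ 0#) R

    -- One relation at a time: `r` is rewritten by the projection found so far to `r′`, which tests
    -- still annihilate by `π-test`, and then one coordinate occurring in `r′` is solved for and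
    -- substituted.
    project : ∀ R → ListAll.All Annihilated R → Projection R
    project [] [] = record
      { π = δ ; π-test = λ s {E} _ → δ-· s E ; π-zero = λ _ → refl ; π-kill = [] }
    -- Coordinate zero is excluded as a pivot, because solving for it would alter the constant 1.
    project (r ∷ R) (r⊥ ∷ R⊥) = step (Finₚ.any? λ t → ¬? (r′ (suc t) ≟ 0#))
      where
      open Projection (project R R⊥)

      r′ : Vector F (suc n)
      r′ q = r · (λ s → π s q)

      r′⊥ : Annihilated r′
      r′⊥ {E} E∈ = begin
        r′ · E                 ≡⟨ ·-assoc r π E ⟨
        r · (λ s → π s · E)    ≡⟨ ·-congʳ r (λ s → π-test s E∈) ⟩
        r · E                  ≡⟨ r⊥ E∈ ⟩
        0#                     ∎

      step : Dec (∃ λ t → r′ (suc t) ≢ 0#) → Projection (r ∷ R)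
      step (no none) = record
        { π = π ; π-test = π-test ; π-zero = π-zero ; π-kill = r′≡0 ∷ π-kill }
        where
        r′≡0-suc : ∀ t → r′ (suc t) ≡ 0#
        r′≡0-suc t = decidable-stable (r′ (suc t) ≟ 0#) λ ≢0 → none (t , ≢0)

        r′≡0 : ∀ q → r′ q ≡ 0#
        r′≡0 (suc t) = r′≡0-suc t
        -- A relation without pivot says that a constant is zero; testing it with `E₀`, whose
        -- constant coordinate is 1, shows that the constant is zero indeed.
        r′≡0 zero    = begin
          r′ zero                                   ≡⟨ *-identityʳ _ ⟨
          r′ zero * 1#                              ≡⟨ cong (r′ zero *_) E₀-zero ⟨
          r′ zero * E₀ zero                         ≡⟨ +-identityʳ _ ⟨
          r′ zero * E₀ zero + 0#                    ≡⟨ cong (r′ zero * E₀ zero +_) (·-zeroˡ (E₀ ∘ suc) r′≡0-suc) ⟨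
          r′ · E₀                                   ≡⟨ r′⊥ E₀-test ⟩
          0#                                        ∎
      step (yes (t , pivot)) = record
        { π = π′ ; π-test = π′-test ; π-zero = π′-zero ; π-kill = kill-r ∷ ListAll.map (λ {w} → kill-R w) π-kill }
        where
        c = proj₁ (inverse (r′ (suc t)) pivot)

        -- Since `c` normalises the pivot coefficient to 1, adding `m` to the unit vector at `suc t`
        -- cancels its pivot entry: this is the expression substituted for that coordinate.
        m : Vector F (suc n)
        m q = (- c) * r′ q

        π′ : Fin (suc n) → Vector F (suc n)
        π′ s q = π s q + π s (suc t) * m q

        π′-test : ∀ s {E} → Test E → π′ s · E ≡ E s
        π′-test s {E} E∈ = begin
          π′ s · E                                          ≡⟨ ·-+ˡ (π s) (λ q → π s (suc t) * m q) E ⟩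
          π s · E + (λ q → π s (suc t) * m q) · E           ≡⟨ cong (π s · E +_) (·-*ˡ (π s (suc t)) m E) ⟩
          π s · E + π s (suc t) * (m · E)                   ≡⟨ cong (λ x → π s · E + π s (suc t) * x) m⊥ ⟩
          π s · E + π s (suc t) * 0#                        ≡⟨ cong (π s · E +_) (zeroʳ _) ⟩
          π s · E + 0#                                      ≡⟨ +-identityʳ _ ⟩
          π s · E                                           ≡⟨ π-test s E∈ ⟩
          E s                                               ∎
          where
          m⊥ : m · E ≡ 0#
          m⊥ = trans (·-*ˡ (- c) r′ E) (trans (cong ((- c) *_) (r′⊥ E∈)) (zeroʳ (- c)))

        π′-zero : π′ zero ≗ δ zero
        π′-zero q = begin
          π zero q + π zero (suc t) * m q   ≡⟨ cong (λ x → π zero q + x * m q) (π-zero (suc t)) ⟩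
          π zero q + 0# * m q               ≡⟨ cong (π zero q +_) (zeroˡ (m q)) ⟩
          π zero q + 0#                     ≡⟨ +-identityʳ _ ⟩
          π zero q                          ≡⟨ π-zero q ⟩
          δ zero q                          ∎

        expand : ∀ w q → w · (λ s → π′ s q) ≡
                 w · (λ s → π s q) + w · (λ s → π s (suc t)) * m q
        expand w q = trans (·-+ʳ w (λ s → π s q) (λ s → π s (suc t) * m q))
          (cong (w · (λ s → π s q) +_) (·-*ʳ (m q) w (λ s → π s (suc t))))

        kill-r : ∀ q → r · (λ s → π′ s q) ≡ 0#
        kill-r q = begin
          r · (λ s → π′ s q)                              ≡⟨ expand r q ⟩
          r′ q + r′ (suc t) * ((- c) * r′ q)              ≡⟨ cong (r′ q +_) (sym (*-assoc _ _ _)) ⟩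
          r′ q + (r′ (suc t) * (- c)) * r′ q              ≡⟨ cong (λ x → r′ q + x * r′ q) (trans (*-comm _ _) (sym (-‿distribˡ-* c _))) ⟩
          r′ q + (- (c * r′ (suc t))) * r′ q              ≡⟨ cong (λ x → r′ q + (- x) * r′ q) (proj₂ (inverse (r′ (suc t)) pivot)) ⟩
          r′ q + (- 1#) * r′ q                            ≡⟨ cong (r′ q +_) (sym (-‿distribˡ-* 1# (r′ q))) ⟩
          r′ q + - (1# * r′ q)                            ≡⟨ cong (λ x → r′ q + - x) (*-identityˡ (r′ q)) ⟩
          r′ q + - r′ q                                   ≡⟨ -‿inverseʳ (r′ q) ⟩
          0#                                              ∎

        -- The substitution acts after `π`, so what `π` has killed stays killed.
        kill-R : ∀ w → (∀ q → w · (λ s → π s q) ≡ 0#) → ∀ q → w · (λ s → π′ s q) ≡ 0#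
        kill-R w w≡0 q = begin
          w · (λ s → π′ s q)                                      ≡⟨ expand w q ⟩
          w · (λ s → π s q) + w · (λ s → π s (suc t)) * m q       ≡⟨ cong₂ (λ x y → x + y * m q) (w≡0 q) (w≡0 (suc t)) ⟩
          0# + 0# * m q                                           ≡⟨ cong (0# +_) (zeroˡ (m q)) ⟩
          0# + 0#                                                 ≡⟨ +-identityˡ 0# ⟩
          0#                                                      ∎

-- The residues modulo a prime as a prime field.

module _ (p : ℕ) (isPrime : Prime p) where

  private
    instance
      p-nonZero : NonZero p
      p-nonZero = prime⇒nonZero isPrime

    module 𝔽 = CommutativeRing (ℤ/ p)
    open RingProperties 𝔽.ring using (-‿distribˡ-*)
    open 𝔽 using (_+_; _*_; -_; 0#; 1#; +-identityˡ; +-identityʳ; +-assoc; -‿inverseʳ)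

    toℕ-mod : ∀ m → toℕ (m mod p) ≡ m % p
    toℕ-mod m = Finₚ.toℕ-fromℕ< (m%n<n m p)

    mod-cong : ∀ {m n} → m % p ≡ n % p → m mod p ≡ n mod p
    mod-cong {m} {n} eq = Finₚ.toℕ-injective (trans (toℕ-mod m) (trans eq (sym (toℕ-mod n))))

    mod-toℕ : ∀ x → toℕ x mod p ≡ x
    mod-toℕ x = Finₚ.toℕ-injective (trans (toℕ-mod (toℕ x)) (m<n⇒m%n≡m (Finₚ.toℕ<n x)))

    mod-+ : ∀ m n → (m mod p) + (n mod p) ≡ (m ℕ.+ n) mod p
    mod-+ m n rewrite toℕ-mod m | toℕ-mod n = mod-cong (sym (%-distribˡ-+ m n p))

    mod-* : ∀ m n → (m mod p) * (n mod p) ≡ (m ℕ.* n) mod p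
    mod-* m n rewrite toℕ-mod m | toℕ-mod n = mod-cong (sym (%-distribˡ-* m n p))

    inverse : ∀ x → x ≢ 0# → ∃ λ y → y * x ≡ 1#
    inverse x x≢0 = fromBézout (coprime-Bézout (prime⇒coprime isPrime {{x-nonZero}} (Finₚ.toℕ<n x)))
      where
      open ≡-Reasoning
      n = toℕ x

      x-nonZero : NonZero n
      x-nonZero = ℕ.≢-nonZero λ n≡0 → x≢0 (trans (sym (mod-toℕ x)) (cong (_mod p) n≡0))

      mod*x : ∀ b → (b mod p) * x ≡ (b ℕ.* n) mod p
      mod*x b = trans (cong ((b mod p) *_) (sym (mod-toℕ x))) (mod-* b n)

      multiple : ∀ a → (a ℕ.* p) mod p ≡ 0#
      multiple a = mod-cong ([m+kn]%n≡m%n 0 a p)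

      fromBézout : Bézout.Identity 1 p n → ∃ λ y → y * x ≡ 1#
      fromBézout (Bézout.-+ a b eq) = b mod p , (begin
        (b mod p) * x             ≡⟨ mod*x b ⟩
        (b ℕ.* n) mod p           ≡⟨ cong (_mod p) (sym eq) ⟩
        (1 ℕ.+ a ℕ.* p) mod p     ≡⟨ mod-cong ([m+kn]%n≡m%n 1 a p) ⟩
        1#                        ∎)
      -- Here 1 + b n = a p, so the Bézout coefficient inverts `x` only up to sign.
      fromBézout (Bézout.+- a b eq) = - (b mod p) , (begin
        (- (b mod p)) * x         ≡⟨ -‿distribˡ-* (b mod p) x ⟨
        - ((b mod p) * x)         ≡⟨ cong -_ (mod*x b) ⟩
        - ((b ℕ.* n) mod p)       ≡⟨ +-identityˡ _ ⟨
        0# + - bn                 ≡⟨ cong (_+ - bn) zero≡ ⟩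
        (1# + bn) + - bn          ≡⟨ +-assoc 1# bn (- bn) ⟩
        1# + (bn + - bn)          ≡⟨ cong (1# +_) (-‿inverseʳ bn) ⟩
        1# + 0#                   ≡⟨ +-identityʳ 1# ⟩
        1#                        ∎)
        where
        bn = (b ℕ.* n) mod p
        zero≡ : 0# ≡ 1# + bn
        zero≡ = begin
          0#                      ≡⟨ multiple a ⟨
          (a ℕ.* p) mod p         ≡⟨ cong (_mod p) (sym eq) ⟩
          (1 ℕ.+ b ℕ.* n) mod p   ≡⟨ mod-+ 1 (b ℕ.* n) ⟨
          1# + bn                 ∎

    multipleOf1 : ∀ x → ∃ λ n → List.foldr _+_ 0# (List.replicate n 1#) ≡ x
    multipleOf1 x = toℕ x , trans (ones (toℕ x)) (mod-toℕ x)
      where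
      ones : ∀ n → List.foldr _+_ 0# (List.replicate n 1#) ≡ n mod p
      ones zero    = refl
      ones (suc n) = trans (cong (1# +_) (ones n)) (mod-+ 1 n)

  ℤₚ : PrimeField
  ℤₚ = record
    { isCommutativeRing = 𝔽.isCommutativeRing
    ; _≟_               = Finₚ._≟_
    ; inverse           = inverse
    ; multipleOf1       = multipleOf1
    }

-- Interpolation of set functions by 0/1-points.

module Points (𝔽 : PrimeField) where

  open Linear 𝔽
  open ≡-Reasoning

  total : ∀ {A : Set} → (A → F) → List A → F
  total f []       = 0#
  total f (x ∷ xs) = f x + total f xs

  total-zero : ∀ {A : Set} {f : A → F} → (∀ x → f x ≡ 0#) → ∀ xs → total f xs ≡ 0#
  total-zero f≡0 []       = refl
  total-zero f≡0 (x ∷ xs) = trans (cong₂ _+_ (f≡0 x) (total-zero f≡0 xs)) (+-identityˡ 0#)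

  total-++ : ∀ {A : Set} (f : A → F) xs ys → total f (xs ++ ys) ≡ total f xs + total f ys
  total-++ f []       ys = sym (+-identityˡ _)
  total-++ f (x ∷ xs) ys = trans (cong (f x +_) (total-++ f xs ys)) (sym (+-assoc _ _ _))

  total-map : ∀ {A B : Set} (f : B → F) (g : A → B) xs → total f (List.map g xs) ≡ total (f ∘ g) xs
  total-map f g []       = refl
  total-map f g (x ∷ xs) = cong (f (g x) +_) (total-map f g xs)

  sum-lookup : ∀ {A : Set} (f : A → F) xs → sum (λ j → f (List.lookup xs j)) ≡ total f xs
  sum-lookup f []       = refl
  sum-lookup f (x ∷ xs) = cong (f x +_) (sum-lookup f xs)

  -- The indicator of the inclusion of `S` in `y`, which is also the value at the point `y` of the
  -- product of the coordinates in `S`.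
  contains : ∀ {n} → Vec Bool n → Vec Bool n → F
  contains []          []      = 1#
  contains (true  ∷ S) (b ∷ y) = if b then contains S y else 0#
  contains (false ∷ S) (b ∷ y) = contains S y

  -- Möbius inversion on the subset lattice, one element at a time.
  points : ∀ {n} → (Vec Bool n → F) → List (Vec Bool n)
  points {zero}  φ = List.replicate (proj₁ (multipleOf1 (φ []))) []
  points {suc n} φ =
    List.map (true ∷_)  (points λ S → φ (true ∷ S)) ++
    List.map (false ∷_) (points λ S → φ (false ∷ S) + - φ (true ∷ S))

  -- If the first bit of the set is false, both halves of the list count, which is why the second
  -- half interpolates a difference; if it is true, only the first half counts. In the base case the
  -- value is the number of copies of the empty point.
  total-contains : ∀ {n} (φ : Vec Bool n → F) S → total (contains S) (points φ) ≡ φ S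
  total-contains {zero} φ [] = trans (ones (proj₁ m)) (proj₂ m)
    where
    m = multipleOf1 (φ [])
    ones : ∀ k → total (contains []) (List.replicate k []) ≡ List.foldr _+_ 0# (List.replicate k 1#)
    ones zero    = refl
    ones (suc k) = cong (1# +_) (ones k)
  total-contains {suc n} φ (b ∷ S) = trans
    (total-++ (contains (b ∷ S)) (List.map (true ∷_) (points φ₁)) _)
    (trans (cong₂ _+_ (total-map (contains (b ∷ S)) (true ∷_) (points φ₁))
                      (total-map (contains (b ∷ S)) (false ∷_) (points φ₀)))
           (split b))
    where
    φ₁ φ₀ : Vec Bool n → F
    φ₁ S = φ (true ∷ S)
    φ₀ S = φ (false ∷ S) + - φ (true ∷ S)
    split : ∀ b → total (contains (b ∷ S) ∘ (true ∷_)) (points φ₁)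
                + total (contains (b ∷ S) ∘ (false ∷_)) (points φ₀) ≡ φ (b ∷ S)
    split true  = trans (cong₂ _+_ (total-contains φ₁ S) (total-zero (λ _ → refl) (points φ₀)))
                        (+-identityʳ _)
    split false = begin
      total (contains S) (points φ₁) + total (contains S) (points φ₀)
        ≡⟨ cong₂ _+_ (total-contains φ₁ S) (total-contains φ₀ S) ⟩
      φ (true ∷ S) + (φ (false ∷ S) + - φ (true ∷ S))   ≡⟨ +-comm _ _ ⟩
      (φ (false ∷ S) + - φ (true ∷ S)) + φ (true ∷ S)   ≡⟨ +-assoc _ _ _ ⟩
      φ (false ∷ S) + (- φ (true ∷ S) + φ (true ∷ S))   ≡⟨ cong (φ (false ∷ S) +_) (-‿inverseˡ _) ⟩
      φ (false ∷ S) + 0#                                ≡⟨ +-identityʳ _ ⟩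
      φ (false ∷ S)                                     ∎

  bit : Bool → F
  bit b = if b then 1# else 0#

  characteristic : ∀ {n} → List (Fin n) → Vec Bool n
  characteristic []      = Vec.replicate _ false
  characteristic (s ∷ L) = characteristic L Vec.[ s ]≔ true

  -- Inserting an element that is already present is covered as well, because a bit is idempotent.
  contains-insert : ∀ {n} (S : Vec Bool n) s y →
                    contains (S Vec.[ s ]≔ true) y ≡ bit (Vec.lookup y s) * contains S y
  contains-insert (true  ∷ S) zero    (true  ∷ y) = sym (*-identityˡ _)
  contains-insert (true  ∷ S) zero    (false ∷ y) = sym (zeroˡ _)
  contains-insert (false ∷ S) zero    (true  ∷ y) = sym (*-identityˡ _)
  contains-insert (false ∷ S) zero    (false ∷ y) = sym (zeroˡ _)
  contains-insert (true  ∷ S) (suc s) (true  ∷ y) = contains-insert S s y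
  contains-insert (true  ∷ S) (suc s) (false ∷ y) = sym (zeroʳ _)
  contains-insert (false ∷ S) (suc s) (b ∷ y)     = contains-insert S s y

  contains-∅ : ∀ {n} (y : Vec Bool n) → contains (Vec.replicate n false) y ≡ 1#
  contains-∅ []      = refl
  contains-∅ (_ ∷ y) = contains-∅ y

  members : ∀ {n} → Vec Bool n → List (Fin n)
  members []          = []
  members (true  ∷ S) = zero ∷ List.map suc (members S)
  members (false ∷ S) = List.map suc (members S)

  ∈-members⁺ : ∀ {n} (S : Vec Bool n) {s} → Vec.lookup S s ≡ true → s ∈ members S
  ∈-members⁺ (true  ∷ S) {zero}  eq = here refl
  ∈-members⁺ (true  ∷ S) {suc s} eq = there (∈ₚ.∈-map⁺ suc (∈-members⁺ S eq))
  ∈-members⁺ (false ∷ S) {suc s} eq = ∈ₚ.∈-map⁺ suc (∈-members⁺ S eq)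

  ∈-members⁻ : ∀ {n} (S : Vec Bool n) {s} → s ∈ members S → Vec.lookup S s ≡ true
  ∈-members⁻ (true  ∷ S) (here refl) = refl
  ∈-members⁻ (true  ∷ S) (there s∈) with _ , t∈ , refl ← ∈ₚ.∈-map⁻ suc s∈ = ∈-members⁻ S t∈
  ∈-members⁻ (false ∷ S) s∈         with _ , t∈ , refl ← ∈ₚ.∈-map⁻ suc s∈ = ∈-members⁻ S t∈

  members-∅ : ∀ n → members (Vec.replicate n false) ≡ []
  members-∅ zero    = refl
  members-∅ (suc n) = cong (List.map suc) (members-∅ n)

  lookup-insert : ∀ {n} (S : Vec Bool n) s t → Vec.lookup (S Vec.[ s ]≔ true) t ≡ true →
                  t ≡ s ⊎ Vec.lookup S t ≡ true
  lookup-insert S s t eq with t Finₚ.≟ s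
  ... | yes t≡s = inj₁ t≡s
  ... | no  t≢s = inj₂ (trans (sym (Vecₚ.lookup∘updateAt′ t s t≢s S)) eq)

  length-insert : ∀ {n} (S : Vec Bool n) s →
                  List.length (members (S Vec.[ s ]≔ true)) ≤ suc (List.length (members S))
  length-insert (true  ∷ S) zero    = ℕₚ.n≤1+n _
  length-insert (false ∷ S) zero    = ℕₚ.≤-refl
  length-insert (true  ∷ S) (suc s)
    rewrite Listₚ.length-map {B = Fin _} suc (members S)
          | Listₚ.length-map {B = Fin _} suc (members (S Vec.[ s ]≔ true)) = s≤s (length-insert S s)
  length-insert (false ∷ S) (suc s)
    rewrite Listₚ.length-map {B = Fin _} suc (members S)
          | Listₚ.length-map {B = Fin _} suc (members (S Vec.[ s ]≔ true)) = length-insert S s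

  ⊆-characteristic : ∀ {n} (L : List (Fin n)) → L ⊆ members (characteristic L)
  ⊆-characteristic L = ∈-members⁺ (characteristic L) ∘ marked L
    where
    marked : ∀ L {s} → s ∈ L → Vec.lookup (characteristic L) s ≡ true
    marked (s ∷ L) (here refl) = Vecₚ.lookup∘updateAt s (characteristic L)
    marked (s ∷ L) {t} (there t∈) with t Finₚ.≟ s
    ... | yes refl = Vecₚ.lookup∘updateAt s (characteristic L)
    ... | no  t≢s  = trans (Vecₚ.lookup∘updateAt′ t s t≢s (characteristic L)) (marked L t∈)

  characteristic-⊆ : ∀ {n} (L : List (Fin n)) → members (characteristic L) ⊆ L
  characteristic-⊆ {n} [] {s} s∈ with () ← subst (s ∈_) (members-∅ n) s∈
  characteristic-⊆ (s ∷ L) {t} t∈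
    with lookup-insert (characteristic L) s t (∈-members⁻ (characteristic (s ∷ L)) t∈)
  ... | inj₁ t≡s = here t≡s
  ... | inj₂ eq  = there (characteristic-⊆ L (∈-members⁺ (characteristic L) eq))

  length-characteristic : ∀ {n} (L : List (Fin n)) → List.length (members (characteristic L)) ≤ List.length L
  length-characteristic {n} [] = ℕₚ.≤-reflexive (cong List.length (members-∅ n))
  length-characteristic (s ∷ L) =
    ℕₚ.≤-trans (length-insert (characteristic L) s) (s≤s (length-characteristic L))

  monomial : ∀ {A : Set} {N} → (A → Vector F N) → List A → Vector F N
  monomial y []      _ = 1#
  monomial y (s ∷ L)   = y s ∙ monomial y L

  SupportInvariant : ∀ {A : Set} → ℕ → (List A → F) → Set
  SupportInvariant k Φ = ∀ {L L′} → List.length L ≤ k → List.length L′ ≤ k →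
                         L ⊆ L′ → L′ ⊆ L → Φ L ≡ Φ L′

  -- The coordinates of `y s` are the bits at `s` of the points, so a monomial is an inclusion
  -- indicator and its sum is inverted by `points`. All subsets are interpolated, including those of
  -- more than `k` elements, where any values would do.
  interpolate : ∀ {n} k (Φ : List (Fin n) → F) → SupportInvariant k Φ →
                ∃ λ N → Σ (Fin n → Vector F N) λ y →
                ∀ L → List.length L ≤ k → sum (monomial y L) ≡ Φ L
  interpolate {n} k Φ supp = List.length pts , y , λ L |L|≤k → begin
    sum (monomial y L)                                       ≡⟨ sum-cong-≗ (monomial≡ L) ⟩
    sum (λ j → contains (characteristic L) (List.lookup pts j)) ≡⟨ sum-lookup (contains (characteristic L)) pts ⟩
    total (contains (characteristic L)) pts                  ≡⟨ total-contains (Φ ∘ members) (characteristic L) ⟩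
    Φ (members (characteristic L))                           ≡⟨ supp (ℕₚ.≤-trans (length-characteristic L) |L|≤k) |L|≤k
                                                                   (characteristic-⊆ L) (⊆-characteristic L) ⟩
    Φ L                                                      ∎
    where
    pts = points (Φ ∘ members)
    y : Fin n → Vector F (List.length pts)
    y s j = bit (Vec.lookup (List.lookup pts j) s)
    monomial≡ : ∀ L j → monomial y L j ≡ contains (characteristic L) (List.lookup pts j)
    monomial≡ []      j = sym (contains-∅ (List.lookup pts j))
    monomial≡ (s ∷ L) j = trans (cong (y s j *_) (monomial≡ L j))
                                (sym (contains-insert (characteristic L) s (List.lookup pts j)))

-- Vectors with prescribed sums of products that satisfy linear relations exactly.

module Realisation (𝔽 : PrimeField) where

  open Linear 𝔽
  open Points 𝔽
  open Elimination 𝔽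
  open ≡-Reasoning

  infixr 5 _◂_

  _◂_ : ∀ {n} → F → Vector F n → Vector F (suc n)
  (x ◂ E) zero    = x
  (x ◂ E) (suc s) = E s

  module _ {n} k (Φ : List (Fin n) → F) (supp : SupportInvariant (suc k) Φ) (Φ-[] : Φ [] ≡ 1#) where

    -- The test vector of `L`: pairing a relation with it computes the prescribed sum of the
    -- relation multiplied by the monomial of `L`.
    extension : List (Fin n) → Vector F (suc n)
    extension L = Φ L ◂ λ s → Φ (s ∷ L)

    -- The vectors `v` arise from the interpolating vectors `y` by applying `π` at each of the `N`
    -- coordinates. Tests have length at most `k`, one less than the monomials, because the relation
    -- itself takes the place of one factor.
    realise : (R : List (Vector F (suc n))) →
              ListAll.All (λ r → ∀ L → List.length L ≤ k → r · extension L ≡ 0#) R →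
              ∃ λ N → Σ (Fin n → Vector F N) λ y →
              (∀ L → List.length L ≤ suc k → sum (monomial y L) ≡ Φ L) ×
              ListAll.All (λ r → ∀ j → r · (1# ◂ λ s → y s j) ≡ 0#) R
    realise R R⊥ = N , v , sum-v , ListAll.map (λ {r} → kill r) π-kill
      where
      Test : Vector F (suc n) → Set
      Test E = ∃ λ L → List.length L ≤ k × E ≡ extension L

      R-annihilated : ListAll.All (λ r → ∀ {E} → Test E → r · E ≡ 0#) R
      R-annihilated = ListAll.map (λ { r⊥ (L , |L|≤k , refl) → r⊥ L |L|≤k }) R⊥

      -- The test of the empty list has constant coordinate `Φ []`, which is 1, as the elimination
      -- demands of `E₀`.
      open Projection (project Test (extension []) ([] , z≤n , refl) Φ-[] R R-annihilated)

      points′ = interpolate (suc k) Φ supp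
      N = proj₁ points′
      y = proj₁ (proj₂ points′)
      sum-y = proj₂ (proj₂ points′)

      v⁺ : Fin N → Vector F (suc n)
      v⁺ j s = π s · (1# ◂ λ q → y q j)

      v : Fin n → Vector F N
      v s j = v⁺ j (suc s)

      v⁺≡ : ∀ j → v⁺ j ≗ (1# ◂ λ s → v s j)
      v⁺≡ j zero    = trans (·-congˡ (1# ◂ λ q → y q j) π-zero) (δ-· zero (1# ◂ λ q → y q j))
      v⁺≡ j (suc s) = refl

      kill : ∀ r → (∀ q → r · (λ s → π s q) ≡ 0#) → ∀ j → r · (1# ◂ λ s → v s j) ≡ 0#
      kill r r≡0 j = begin
        r · (1# ◂ λ s → v s j)                                   ≡⟨ ·-congʳ r (v⁺≡ j) ⟨
        r · v⁺ j                                                 ≡⟨ ·-assoc r π (1# ◂ λ q → y q j) ⟩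
        (λ q → r · (λ s → π s q)) · (1# ◂ λ q → y q j)           ≡⟨ ·-zeroˡ (1# ◂ λ q → y q j) r≡0 ⟩
        0#                                                       ∎

      length-middle : ∀ (s : Fin n) L M → List.length (L ++ s ∷ M) ≡ List.length (s ∷ L ++ M)
      length-middle s L M =
        trans (Listₚ.length-++ L) (trans (ℕₚ.+-suc _ _) (cong suc (sym (Listₚ.length-++ L))))

      rotate : ∀ s L M → List.length (s ∷ L ++ M) ≤ suc k → Φ (L ++ s ∷ M) ≡ Φ (s ∷ L ++ M)
      rotate s L M len = supp (ℕₚ.≤-trans (ℕₚ.≤-reflexive (length-middle s L M)) len) len forth back
        where
        forth : L ++ s ∷ M ⊆ s ∷ L ++ M
        forth t∈ with ∈ₚ.∈-++⁻ L t∈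
        ... | inj₁ t∈L         = there (∈ₚ.∈-++⁺ˡ t∈L)
        ... | inj₂ (here t≡s)  = here t≡s
        ... | inj₂ (there t∈M) = there (∈ₚ.∈-++⁺ʳ L t∈M)
        back : s ∷ L ++ M ⊆ L ++ s ∷ M
        back (here t≡s) = ∈ₚ.∈-++⁺ʳ L (here t≡s)
        back (there t∈) with ∈ₚ.∈-++⁻ L t∈
        ... | inj₁ t∈L = ∈ₚ.∈-++⁺ˡ t∈L
        ... | inj₂ t∈M = ∈ₚ.∈-++⁺ʳ L (there t∈M)

      -- The factors v are replaced by their expansions one after the other.
      sum-monomial : ∀ L M → List.length (L ++ M) ≤ suc k →
                     sum (monomial v L ∙ monomial y M) ≡ Φ (L ++ M)
      sum-monomial []      M len = trans (sum-cong-≗ λ j → *-identityˡ (monomial y M j)) (sum-y M len)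
      sum-monomial (s ∷ L) M len = begin
        sum (λ j → (v s j * monomial v L j) * monomial y M j)    ≡⟨ sum-cong-≗ (λ j → *-assoc (v s j) _ _) ⟩
        sum (λ j → v s j * z j)                                  ≡⟨ sum-cong-≗ (λ j → ·-*ʳ (z j) (π (suc s)) (e j)) ⟨
        sum (λ j → π (suc s) · (λ q → e j q * z j))              ≡⟨ ∑-comm (λ j q → π (suc s) q * (e j q * z j)) ⟩
        sum (λ q → sum λ j → π (suc s) q * (e j q * z j))        ≡⟨ sum-cong-≗ (λ q → *-distribˡ-sum (π (suc s) q) (λ j → e j q * z j)) ⟨
        π (suc s) · (λ q → sum λ j → e j q * z j)                ≡⟨ ·-congʳ (π (suc s)) replaced ⟩
        π (suc s) · extension (L ++ M)                           ≡⟨ π-test (suc s) (L ++ M , ℕₚ.≤-pred len , refl) ⟩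
        Φ (s ∷ L ++ M)                                           ∎
        where
        z : Vector F N
        z = monomial v L ∙ monomial y M
        e : Fin N → Vector F (suc n)
        e j = 1# ◂ λ q → y q j
        replaced : ∀ q → sum (λ j → e j q * z j) ≡ extension (L ++ M) q
        replaced zero    = trans (sum-cong-≗ λ j → *-identityˡ (z j))
                                 (sum-monomial L M (ℕₚ.≤-trans (ℕₚ.n≤1+n _) len))
        replaced (suc q) = begin
          sum (λ j → y q j * (monomial v L j * monomial y M j))  ≡⟨ sum-cong-≗ (λ j → x∙yz≈y∙xz (y q j) (monomial v L j) (monomial y M j)) ⟩
          sum (monomial v L ∙ monomial y (q ∷ M))                ≡⟨ sum-monomial L (q ∷ M) (ℕₚ.≤-trans (ℕₚ.≤-reflexive (length-middle q L M)) len) ⟩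
          Φ (L ++ q ∷ M)                                         ≡⟨ rotate q L M len ⟩
          Φ (q ∷ L ++ M)                                         ∎

      sum-v : ∀ L → List.length L ≤ suc k → sum (monomial v L) ≡ Φ L
      sum-v L len = begin
        sum (monomial v L)                   ≡⟨ sum-cong-≗ (λ j → sym (*-identityʳ (monomial v L j))) ⟩
        sum (monomial v L ∙ monomial y [])   ≡⟨ sum-monomial L [] (subst (λ M → List.length M ≤ suc k) (sym L++[]) len) ⟩
        Φ (L ++ [])                          ≡⟨ cong Φ L++[] ⟩
        Φ L                                  ∎
        where
        L++[] = Listₚ.++-identityʳ L

-- Membership of constraints in the saturated power.

∈-elements : ∀ D x → x ∈ elements D
∈-elements D x = subst (_∈ elements D) (FinSet.strictlyInverseʳ D x) (∈ₚ.∈-tabulate⁺ (FinSet.to D x))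

∈-tuples : ∀ {A : Set} {xs : List A} {k} {v : Vec A k} → All (_∈ xs) v → v ∈ tuples xs k
∈-tuples []         = here refl
∈-tuples (x∈ ∷ xs∈) = ∈ₚ.∈-cartesianProductWith⁺ _∷_ x∈ (∈-tuples xs∈)

identityConstraint : ∀ {X : Set} {Dom : X → FinSet} → X → Constraint Dom
identityConstraint x = constraint x x id

identity∈ : ∀ 𝒟 x → identityConstraint x ∈ withIdentities 𝒟
identity∈ 𝒟 x = ∈ₚ.∈-++⁺ʳ (constraints 𝒟) (∈ₚ.∈-map⁺ identityConstraint (∈-elements (Var 𝒟) x))

productConstraint∈ : ∀ 𝒟 {k} {es : Vec (Constraint (Dom 𝒟)) k} → All (_∈ withIdentities 𝒟) es →
                     productConstraint es ∈ constraints (pow k 𝒟)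
productConstraint∈ 𝒟 es∈ = ∈ₚ.∈-++⁺ˡ (∈ₚ.∈-map⁺ productConstraint (∈-tuples es∈))

reindexConstraint∈ : ∀ 𝒟 {k} (xs : Vec ∣ Var 𝒟 ∣ k) (table : Vec (Fin k) k) →
                     reindexConstraint xs (Vec.lookup table) ∈ constraints (pow k 𝒟)
reindexConstraint∈ 𝒟 {k} xs table = ∈ₚ.∈-++⁺ʳ (List.map productConstraint (tuples (withIdentities 𝒟) k))
  (∈ₚ.∈-cartesianProductWith⁺ (λ xs σ → reindexConstraint xs (Vec.lookup σ))
    (∈-tuples (VecAll.universal (∈-elements (Var 𝒟)) xs))
    (∈-tuples (VecAll.universal ∈ₚ.∈-allFin table)))

-- Sums over finite sets and over products of them.

module FiniteSums (𝔽 : PrimeField) where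

  open Linear 𝔽
  open ≡-Reasoning

  sumOver : (D : FinSet) → (∣ D ∣ → F) → F
  sumOver D f = sum (λ j → f (FinSet.from D j))

  -- For the field of residues this unfolds to `fibreSum`, so statements about it apply to the
  -- minions without conversion.
  pushforward : (D E : FinSet) → (∣ D ∣ → ∣ E ∣) → (∣ D ∣ → F) → ∣ E ∣ → F
  pushforward D E α f b = sumOver D λ a → if does (FinSet._≟_ E (α a) b) then f a else 0#

  if-⇔ : ∀ {A B : Set} (A? : Dec A) (B? : Dec B) {x y : F} → (A → B) → (B → A) → x ≡ y →
         (if does A? then x else 0#) ≡ (if does B? then y else 0#)
  if-⇔ (yes a) B? f g x≡y = trans x≡y (sym (if-yes B? (f a)))
  if-⇔ (no ¬a) B? f g x≡y = sym (if-no B? (¬a ∘ g))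

  if-zero : ∀ {A : Set} (A? : Dec A) {x : F} → (A → x ≡ 0#) → (if does A? then x else 0#) ≡ 0#
  if-zero (yes a) x≡0 = x≡0 a
  if-zero (no _)  x≡0 = refl

  sumOver-cong : ∀ D {f g : ∣ D ∣ → F} → f ≗ g → sumOver D f ≡ sumOver D g
  sumOver-cong D eq = sum-cong-≗ (eq ∘ FinSet.from D)

  sumOver-zero : ∀ D {f : ∣ D ∣ → F} → (∀ a → f a ≡ 0#) → sumOver D f ≡ 0#
  sumOver-zero D eq = sum-zero (eq ∘ FinSet.from D)

  sumOver-swap : ∀ D E (f : ∣ D ∣ → ∣ E ∣ → F) →
                 sumOver D (λ a → sumOver E (f a)) ≡ sumOver E (λ b → sumOver D (λ a → f a b))
  sumOver-swap D E f = ∑-comm (λ i j → f (FinSet.from D i) (FinSet.from E j))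

  sumOver-only : ∀ D (f : ∣ D ∣ → F) d → (∀ a → a ≢ d → f a ≡ 0#) → sumOver D f ≡ f d
  sumOver-only D f d off = trans
    (sum-only (f ∘ D.from) (D.to d)
      (λ i i≢ → off (D.from i) (λ eq → i≢ (trans (sym (D.strictlyInverseˡ i)) (cong D.to eq)))))
    (cong f (D.strictlyInverseʳ d))
    where module D = FinSet D

  sumOver-δ : ∀ D (f : ∣ D ∣ → F) d → sumOver D (λ a → if does (FinSet._≟_ D d a) then f a else 0#) ≡ f d
  sumOver-δ D f d = trans
    (sumOver-only D _ d λ a a≢d → if-no (FinSet._≟_ D d a) (a≢d ∘ sym))
    (if-yes (FinSet._≟_ D d d) refl)

  sumOver-*ʳ : ∀ D (f : ∣ D ∣ → F) x → sumOver D (λ a → f a * x) ≡ sumOver D f * x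
  sumOver-*ʳ D f x = sym (*-distribʳ-sum x (f ∘ FinSet.from D))

  sumOver-*ˡ : ∀ D x (f : ∣ D ∣ → F) → sumOver D (λ a → x * f a) ≡ x * sumOver D f
  sumOver-*ˡ D x f = sym (*-distribˡ-sum x (f ∘ FinSet.from D))

  pushforward-cong : ∀ D E α {f g} → f ≗ g → pushforward D E α f ≗ pushforward D E α g
  pushforward-cong D E α eq b =
    sumOver-cong D λ a → cong (λ x → if does (FinSet._≟_ E (α a) b) then x else 0#) (eq a)

  module _ {X : Set} (Dom : X → FinSet) where

    -- Both sides equal the sum of [ds = d ∷ ds′] g(ds) over all d, ds′ and ds.
    sumOver-∷ : ∀ x {k} (xs : Vec X k) (g : All (∣_∣ ∘ Dom) (x ∷ xs) → F) →
                sumOver (Product Dom (x ∷ xs)) g ≡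
                sumOver (Dom x) λ d → sumOver (Product Dom xs) λ ds → g (d ∷ ds)
    sumOver-∷ x xs g = begin
      sumOver P g                                                   ≡⟨ sumOver-cong P collapse ⟨
      (sumOver P λ c → sumOver A λ a → sumOver B λ b → term a b c)  ≡⟨ sumOver-swap P A (λ c a → sumOver B λ b → term a b c) ⟩
      (sumOver A λ a → sumOver P λ c → sumOver B λ b → term a b c)  ≡⟨ sumOver-cong A (λ a → sumOver-swap P B (λ c b → term a b c)) ⟩
      (sumOver A λ a → sumOver B λ b → sumOver P λ c → term a b c)  ≡⟨ sumOver-cong A (λ a → sumOver-cong B λ b → sumOver-δ P g (a ∷ b)) ⟩
      (sumOver A λ a → sumOver B λ b → g (a ∷ b))                   ∎
      where
      A = Dom x
      B = Product Dom xs
      P = Product Dom (x ∷ xs)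
      term : ∣ A ∣ → ∣ B ∣ → ∣ P ∣ → F
      term a b c = if does (FinSet._≟_ P (a ∷ b) c) then g c else 0#
      collapse : ∀ c → (sumOver A λ a → sumOver B λ b → term a b c) ≡ g c
      collapse (d ∷ ds) = begin
        (sumOver A λ a → sumOver B λ b → term a b (d ∷ ds))
          ≡⟨ sumOver-only A _ d (λ a a≢d → sumOver-zero B λ b → if-no (FinSet._≟_ P (a ∷ b) (d ∷ ds)) (a≢d ∘ cong VecAll.head)) ⟩
        (sumOver B λ b → term d b (d ∷ ds))
          ≡⟨ sumOver-only B _ ds (λ b b≢ds → if-no (FinSet._≟_ P (d ∷ b) (d ∷ ds)) (b≢ds ∘ cong VecAll.tail)) ⟩
        term d ds (d ∷ ds)
          ≡⟨ if-yes (FinSet._≟_ P (d ∷ ds) (d ∷ ds)) refl ⟩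
        g (d ∷ ds) ∎

-- Dependent tuples as plain vectors of tokens.

module Tuples {X : Set} (Dom : X → FinSet) where

  Token : Set
  Token = Σ X (∣_∣ ∘ Dom)

  Tuple : ∀ {k} → Vec X k → Set
  Tuple = All (∣_∣ ∘ Dom)

  -- The type of a tuple depends on its variables, that of a token vector does not; so tuples over
  -- different or only propositionally equal variable vectors can be compared without transport.
  tokens : ∀ {k} (xs : Vec X k) → Tuple xs → Vec Token k
  tokens []       []       = []
  tokens (x ∷ xs) (d ∷ ds) = (x , d) ∷ tokens xs ds

  vars : ∀ {k} → Vec Token k → Vec X k
  vars = Vec.map proj₁

  entries : ∀ {k} (T : Vec Token k) → Tuple (vars T)
  entries []            = []
  entries ((x , d) ∷ T) = d ∷ entries T

  tokens-entries : ∀ {k} (T : Vec Token k) → tokens (vars T) (entries T) ≡ T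
  tokens-entries []      = refl
  tokens-entries (t ∷ T) = cong (t ∷_) (tokens-entries T)

  vars-tokens : ∀ {k} (xs : Vec X k) ds → vars (tokens xs ds) ≡ xs
  vars-tokens []       []       = refl
  vars-tokens (x ∷ xs) (d ∷ ds) = cong (x ∷_) (vars-tokens xs ds)

  -- The recovered entries and `ds` have different types; quantifying over `f` replaces variables
  -- and entries simultaneously.
  entries-tokens : ∀ {A : Set} {k} (f : ∀ xs → Tuple {k} xs → A) xs ds →
                   f (vars (tokens xs ds)) (entries (tokens xs ds)) ≡ f xs ds
  entries-tokens f []       []       = refl
  entries-tokens f (x ∷ xs) (d ∷ ds) = entries-tokens (λ ys es → f (x ∷ ys) (d ∷ es)) xs ds

  tokens-injective : ∀ {k} (xs : Vec X k) {ds es} → tokens xs ds ≡ tokens xs es → ds ≡ es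
  tokens-injective []       {[]}     {[]}     eq = refl
  tokens-injective (x ∷ xs) {d ∷ ds} {e ∷ es} eq with Vecₚ.∷-injective eq
  ... | refl , eq′ = cong (d ∷_) (tokens-injective xs eq′)

  fill : ∀ {k} (xs : Vec X k) T → vars T ≡ xs → ∃ λ ds → tokens xs ds ≡ T
  fill _ T refl = entries T , tokens-entries T

  lookup-tokens : ∀ {k} (xs : Vec X k) ds i → Vec.lookup (tokens xs ds) i ≡ (Vec.lookup xs i , lookup⁺ ds i)
  lookup-tokens (x ∷ xs) (d ∷ ds) zero    = refl
  lookup-tokens (x ∷ xs) (d ∷ ds) (suc i) = lookup-tokens xs ds i

  tokens-tabulate : ∀ {k} (f : Fin k → X) (g : ∀ i → ∣ Dom (f i) ∣) →
                    tokens (Vec.tabulate f) (tabulate⁺ g) ≡ Vec.tabulate (λ i → f i , g i)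
  tokens-tabulate {zero}  f g = refl
  tokens-tabulate {suc k} f g = cong ((f zero , g zero) ∷_) (tokens-tabulate (f ∘ suc) (λ i → g (suc i)))

  tokens-⋆ : ∀ {k} (σ : Fin k → Fin k) (xs : Vec X k) ds →
             tokens (reindex {Dom = Dom} σ xs) (_⋆ {Dom = Dom} σ ds) ≡ reindex {Dom = Dom} σ (tokens xs ds)
  tokens-⋆ σ xs ds = trans (tokens-tabulate (Vec.lookup xs ∘ σ) (λ i → lookup⁺ ds (σ i)))
    (Vecₚ.tabulate-cong λ i → sym (lookup-tokens xs ds (σ i)))

-- Moments from a solution of the saturated power.

module Moment (𝔽 : PrimeField) (𝒟 : LC) where

  open Linear 𝔽
  open Points 𝔽 using (SupportInvariant)
  open FiniteSums 𝔽
  open Tuples (Dom 𝒟)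
  open ≡-Reasoning

  private
    X = ∣ Var 𝒟 ∣
    D = Dom 𝒟

  -- Ψ L is the value prescribed for 𝔴 of the product of the vectors of the
  -- tokens in L.
  record Moments (k : ℕ) : Set where
    field
      Ψ            : List Token → F
      Ψ-[]         : Ψ [] ≡ 1#
      Ψ-support    : SupportInvariant k Ψ
      Ψ-conflict   : ∀ {x d d′} L → d ≢ d′ → Ψ ((x , d) ∷ (x , d′) ∷ L) ≡ 0#
      Ψ-sum        : ∀ x L → List.length L < k →
                     sumOver (D x) (λ d → Ψ ((x , d) ∷ L)) ≡ Ψ L
      Ψ-constraint : ∀ {e} → e ∈ constraints 𝒟 → ∀ d L → List.length L < k →
                     Ψ ((lhs e , d) ∷ L) ≡
                     pushforward (D (rhs e)) (D (lhs e)) (apply e) (λ a → Ψ ((rhs e , a) ∷ L)) d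

  module FromPower (k″ : ℕ) where

    private
      k′ k : ℕ
      k′ = suc k″
      k  = suc k′

    module _
      (μ : (xs : Vec X k) → Tuple xs → F)
      (μ-sum : ∀ xs → sumOver (Product D xs) (μ xs) ≡ 1#)
      (μ-constraint : ∀ {e} → e ∈ constraints (pow k 𝒟) → ∀ ds → μ (lhs e) ds ≡
        pushforward (Product D (rhs e)) (Product D (lhs e)) (apply e) (μ (rhs e)) ds)
      where

      density : Vec Token k → F
      density T = μ (vars T) (entries T)

      density-tokens : ∀ xs ds → density (tokens xs ds) ≡ μ xs ds
      density-tokens = entries-tokens μ

      _≟ₜ_ : DecidableEquality Token
      _≟ₜ_ = Productₚ.≡-dec (FinSet._≟_ (Var 𝒟)) (λ {x} → FinSet._≟_ (D x))

      _≟ᵥ_ : ∀ {m} → DecidableEquality (Vec Token m)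
      _≟ᵥ_ = Vecₚ.≡-dec _≟ₜ_

      infix 25 _⟨_⟩

      _⟨_⟩ : ∀ {A : Set} → Vec A k → (Fin k → Fin k) → Vec A k
      T ⟨ σ ⟩ = Vec.tabulate (Vec.lookup T ∘ σ)

      -- The constraint of type (2) for `σ`, restated for token vectors.
      density-reindex : ∀ σ xs U → vars U ≡ xs ⟨ σ ⟩ → density U ≡
        sumOver (Product D xs) λ ds →
          if does ((tokens xs ds ⟨ σ ⟩) ≟ᵥ U) then density (tokens xs ds) else 0#
      density-reindex σ xs U eq = begin
        density U                               ≡⟨ cong density tokens-es ⟨
        density (tokens (xs ⟨ σ′ ⟩) es)         ≡⟨ density-tokens (xs ⟨ σ′ ⟩) es ⟩
        μ (xs ⟨ σ′ ⟩) es                        ≡⟨ μ-constraint (reindexConstraint∈ 𝒟 xs (Vec.tabulate σ)) es ⟩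
        pushforward (Product D xs) (Product D (xs ⟨ σ′ ⟩)) (_⋆ {Dom = D} σ′) (μ xs) es
          ≡⟨ sumOver-cong (Product D xs) (λ ds → if-⇔ (FinSet._≟_ (Product D (xs ⟨ σ′ ⟩)) (_⋆ {Dom = D} σ′ ds) es)
               ((tokens xs ds ⟨ σ ⟩) ≟ᵥ U) (forth ds) (back ds) (sym (density-tokens xs ds))) ⟩
        sumOver (Product D xs) (λ ds →
          if does ((tokens xs ds ⟨ σ ⟩) ≟ᵥ U) then density (tokens xs ds) else 0#) ∎
        where
        -- The power enumerates tables, so its constraint is about lookup in the table of `σ`, which
        -- agrees with `σ` only pointwise.
        σ′ = Vec.lookup (Vec.tabulate σ)
        σ′≗σ : ∀ {A : Set} (T : Vec A k) → T ⟨ σ′ ⟩ ≡ T ⟨ σ ⟩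
        σ′≗σ T = Vecₚ.tabulate-cong λ i → cong (Vec.lookup T) (Vecₚ.lookup∘tabulate σ i)
        filled = fill (xs ⟨ σ′ ⟩) U (trans eq (sym (σ′≗σ xs)))
        es = proj₁ filled
        tokens-es = proj₂ filled
        tokens-⟨⟩ : ∀ ds → tokens (xs ⟨ σ′ ⟩) (_⋆ {Dom = D} σ′ ds) ≡ tokens xs ds ⟨ σ ⟩
        tokens-⟨⟩ ds = trans (tokens-⋆ σ′ xs ds) (σ′≗σ (tokens xs ds))
        forth : ∀ ds → _⋆ {Dom = D} σ′ ds ≡ es → tokens xs ds ⟨ σ ⟩ ≡ U
        forth ds eq = trans (sym (tokens-⟨⟩ ds)) (trans (cong (tokens (xs ⟨ σ′ ⟩)) eq) tokens-es)
        back : ∀ ds → tokens xs ds ⟨ σ ⟩ ≡ U → _⋆ {Dom = D} σ′ ds ≡ es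
        back ds eq = tokens-injective (xs ⟨ σ′ ⟩) (trans (tokens-⟨⟩ ds) (trans eq (sym tokens-es)))

      lookup-vars : ∀ {m} (T : Vec Token m) i → Vec.lookup (vars T) i ≡ proj₁ (Vec.lookup T i)
      lookup-vars T i = Vecₚ.lookup-map i proj₁ T

      lookup-⟨⟩ : ∀ {A : Set} (T : Vec A k) σ i → Vec.lookup (T ⟨ σ ⟩) i ≡ Vec.lookup T (σ i)
      lookup-⟨⟩ T σ i = Vecₚ.lookup∘tabulate (Vec.lookup T ∘ σ) i

      lookup-extensional : ∀ {A : Set} {m} {T U : Vec A m} → (∀ i → Vec.lookup T i ≡ Vec.lookup U i) → T ≡ U
      lookup-extensional {T = T} {U} eq =
        trans (sym (Vecₚ.tabulate∘lookup T)) (trans (Vecₚ.tabulate-cong eq) (Vecₚ.tabulate∘lookup U))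

      difference : ∀ {m} (T U : Vec Token m) → T ≢ U → ∃ λ i → Vec.lookup T i ≢ Vec.lookup U i
      difference T U T≢U with Finₚ.any? (λ i → ¬? (Vec.lookup T i ≟ₜ Vec.lookup U i))
      ... | yes found = found
      ... | no  none  = contradiction
        (lookup-extensional λ i → decidable-stable (Vec.lookup T i ≟ₜ Vec.lookup U i) λ ≢ → none (i , ≢)) T≢U

      -- Reindexing along the σ that sends i to m and fixes everything else
      -- keeps the variables of U but no tuple of entries is sent to U.
      density-conflict : ∀ U m i → proj₁ (Vec.lookup U m) ≡ proj₁ (Vec.lookup U i) →
                         Vec.lookup U m ≢ Vec.lookup U i → density U ≡ 0#
      density-conflict U m i same-var U-m≢U-i = trans (density-reindex σ (vars U) U vars≡)
        (sumOver-zero (Product D (vars U)) λ ds →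
          if-zero ((tokens (vars U) ds ⟨ σ ⟩) ≟ᵥ U) {density (tokens (vars U) ds)} λ eq → contradiction (U-m≡U-i (tokens (vars U) ds) eq) U-m≢U-i)
        where
        σ : Fin k → Fin k
        σ j = if does (j Finₚ.≟ i) then m else j
        σ-i : σ i ≡ m
        σ-i with i Finₚ.≟ i
        ... | yes _  = refl
        ... | no i≢i = contradiction refl i≢i
        σ-m : σ m ≡ m
        σ-m with m Finₚ.≟ i
        ... | yes _ = refl
        ... | no _  = refl
        vars≡ : vars U ≡ vars U ⟨ σ ⟩
        vars≡ = lookup-extensional λ j → trans (fixed j) (sym (lookup-⟨⟩ (vars U) σ j))
          where
          fixed : ∀ j → Vec.lookup (vars U) j ≡ Vec.lookup (vars U) (σ j)
          fixed j with j Finₚ.≟ i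
          ... | yes refl = trans (lookup-vars U i) (trans (sym same-var) (sym (lookup-vars U m)))
          ... | no _     = refl
        U-m≡U-i : ∀ T → T ⟨ σ ⟩ ≡ U → Vec.lookup U m ≡ Vec.lookup U i
        U-m≡U-i T refl = begin
          Vec.lookup (T ⟨ σ ⟩) m  ≡⟨ lookup-⟨⟩ T σ m ⟩
          Vec.lookup T (σ m)      ≡⟨ cong (Vec.lookup T) (trans σ-m (sym σ-i)) ⟩
          Vec.lookup T (σ i)      ≡⟨ lookup-⟨⟩ T σ i ⟨
          Vec.lookup (T ⟨ σ ⟩) i  ∎

      _≼_ : ∀ {m n} → Vec Token m → Vec Token n → Set
      T ≼ U = ∀ i → ∃ λ j → Vec.lookup T i ≡ Vec.lookup U j

      -- The first inclusion makes `T` a reindexing of `U`, so the density of `T` is a sum over all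
      -- `W` with the variables of `U` that are sent to `T`. By the second inclusion every such `W`
      -- other than `U` gives two values to one variable, and only the term of `U` is left.
      density-support : ∀ T U → T ≼ U → U ≼ T → density T ≡ density U
      density-support T U T≼U U≼T = begin
        density T   ≡⟨ density-reindex σ xs T vars≡ ⟩
        sumOver (Product D xs) (λ ds → if does ((tokens xs ds ⟨ σ ⟩) ≟ᵥ T) then density (tokens xs ds) else 0#)
                    ≡⟨ sumOver-only (Product D xs) _ (entries U) off ⟩
        (if does ((tokens xs (entries U) ⟨ σ ⟩) ≟ᵥ T) then density (tokens xs (entries U)) else 0#)
                    ≡⟨ if-yes ((tokens xs (entries U) ⟨ σ ⟩) ≟ᵥ T) (trans (cong _⟨ σ ⟩ (tokens-entries U)) (sym T≡)) ⟩
        density (tokens xs (entries U))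
                    ≡⟨ cong density (tokens-entries U) ⟩
        density U   ∎
        where
        xs = vars U
        σ τ : Fin k → Fin k
        σ i = proj₁ (T≼U i)
        τ i = proj₁ (U≼T i)
        T≡ : T ≡ U ⟨ σ ⟩
        T≡ = lookup-extensional λ i → trans (proj₂ (T≼U i)) (sym (lookup-⟨⟩ U σ i))
        vars≡ : vars T ≡ xs ⟨ σ ⟩
        vars≡ = lookup-extensional λ i → begin
          Vec.lookup (vars T) i         ≡⟨ lookup-vars T i ⟩
          proj₁ (Vec.lookup T i)        ≡⟨ cong proj₁ (proj₂ (T≼U i)) ⟩
          proj₁ (Vec.lookup U (σ i))    ≡⟨ lookup-vars U (σ i) ⟨
          Vec.lookup xs (σ i)           ≡⟨ lookup-⟨⟩ xs σ i ⟨
          Vec.lookup (xs ⟨ σ ⟩) i       ∎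
        vanish : ∀ W → vars W ≡ xs → W ⟨ σ ⟩ ≡ T → W ≢ U → density W ≡ 0#
        vanish W vars-W W⟨σ⟩ W≢U = density-conflict W m i
          (trans (sym (lookup-vars W m)) (trans (cong (λ ys → Vec.lookup ys m) vars-W) (trans (lookup-vars U m)
            (trans (cong proj₁ U-m) (trans (sym (lookup-vars U i)) (trans (cong (λ ys → Vec.lookup ys i) (sym vars-W)) (lookup-vars W i)))))))
          (λ W-m≡W-i → W-i≢U-i (trans (sym W-m≡W-i) (trans W-m U-m)))
          where
          i = proj₁ (difference W U W≢U)
          W-i≢U-i = proj₂ (difference W U W≢U)
          -- A position in the image of `σ` at which `U` has the same token as at `i`. On the image
          -- `W` agrees with `U`, at `i` it does not, so positions `m` and `i` of `W` conflict.
          m = σ (τ i)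
          U-m : Vec.lookup U m ≡ Vec.lookup U i
          U-m = trans (sym (proj₂ (T≼U (τ i)))) (sym (proj₂ (U≼T i)))
          W-m : Vec.lookup W m ≡ Vec.lookup U m
          W-m = begin
            Vec.lookup W m              ≡⟨ lookup-⟨⟩ W σ (τ i) ⟨
            Vec.lookup (W ⟨ σ ⟩) (τ i)  ≡⟨ cong (λ V → Vec.lookup V (τ i)) W⟨σ⟩ ⟩
            Vec.lookup T (τ i)          ≡⟨ proj₂ (T≼U (τ i)) ⟩
            Vec.lookup U m              ∎
        off : ∀ ds → ds ≢ entries U →
              (if does ((tokens xs ds ⟨ σ ⟩) ≟ᵥ T) then density (tokens xs ds) else 0#) ≡ 0#
        off ds ds≢ = if-zero ((tokens xs ds ⟨ σ ⟩) ≟ᵥ T) λ eq →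
          vanish (tokens xs ds) (vars-tokens xs ds) eq
            λ eq′ → ds≢ (tokens-injective xs (trans eq′ (sym (tokens-entries U))))

      -- The reindexing that overwrites slot zero by a copy of another slot forgets exactly the
      -- entry at `x`: the tuples sent to `U` are those with rest `P` and any `d` in front.
      density-marginal : ∀ x (P : Vec Token k′) j →
                         sumOver (D x) (λ d → density ((x , d) ∷ P)) ≡ density (Vec.lookup P j ∷ P)
      density-marginal x P j = sym (begin
        density U                                         ≡⟨ density-reindex σ (x ∷ vars P) U vars≡ ⟩
        sumOver (Product D (x ∷ vars P)) g                ≡⟨ sumOver-∷ D x (vars P) g ⟩
        (sumOver (D x) λ d → sumOver (Product D (vars P)) λ ds → g (d ∷ ds))
                                                          ≡⟨ sumOver-cong (D x) inner ⟩
        sumOver (D x) (λ d → density ((x , d) ∷ P))       ∎)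
        where
        U : Vec Token k
        U = Vec.lookup P j ∷ P
        σ : Fin k → Fin k
        σ zero    = suc j
        σ (suc i) = suc i
        g : Tuple (x ∷ vars P) → F
        g ds = if does ((tokens (x ∷ vars P) ds ⟨ σ ⟩) ≟ᵥ U) then density (tokens (x ∷ vars P) ds) else 0#
        ⟨σ⟩ : ∀ {A : Set} a (Q : Vec A k′) → (a ∷ Q) ⟨ σ ⟩ ≡ Vec.lookup Q j ∷ Q
        ⟨σ⟩ a Q = cong (Vec.lookup Q j ∷_) (Vecₚ.tabulate∘lookup Q)
        vars≡ : vars U ≡ (x ∷ vars P) ⟨ σ ⟩
        vars≡ = sym (trans (⟨σ⟩ x (vars P)) (cong (_∷ vars P) (lookup-vars P j)))
        inner : ∀ d → sumOver (Product D (vars P)) (λ ds → g (d ∷ ds)) ≡ density ((x , d) ∷ P)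
        inner d = trans
          (sumOver-only (Product D (vars P)) (λ ds → g (d ∷ ds)) (entries P) λ ds ds≢ →
            if-no (((((x , d) ∷ tokens (vars P) ds)) ⟨ σ ⟩) ≟ᵥ U) λ eq →
              ds≢ (tokens-injective (vars P) (trans (Vecₚ.∷-injectiveʳ (trans (sym (⟨σ⟩ (x , d) (tokens (vars P) ds))) eq)) (sym (tokens-entries P)))))
          (trans
            (if-yes (((x , d) ∷ tokens (vars P) (entries P)) ⟨ σ ⟩ ≟ᵥ U)
              (trans (cong (λ Q → ((x , d) ∷ Q) ⟨ σ ⟩) (tokens-entries P)) (⟨σ⟩ (x , d) P)))
            (cong (λ Q → density ((x , d) ∷ Q)) (tokens-entries P)))

      -- On the tuple that repeats `x`, any non-constant choice of entries is a conflict, so the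
      -- total mass 1 sits on the constant ones.
      density-diagonal : ∀ x → sumOver (D x) (λ d → density ((x , d) ∷ Vec.replicate k′ (x , d))) ≡ 1#
      density-diagonal x = sym (begin
        1#                                      ≡⟨ μ-sum (x ∷ xs) ⟨
        sumOver (Product D (x ∷ xs)) (μ (x ∷ xs))
          ≡⟨ sumOver-cong (Product D (x ∷ xs)) (density-tokens (x ∷ xs)) ⟨
        sumOver (Product D (x ∷ xs)) (density ∘ tokens (x ∷ xs))
          ≡⟨ sumOver-∷ D x xs (density ∘ tokens (x ∷ xs)) ⟩
        (sumOver (D x) λ d → sumOver (Product D xs) λ ds → density ((x , d) ∷ tokens xs ds))
          ≡⟨ sumOver-cong (D x) inner ⟩
        sumOver (D x) (λ d → density ((x , d) ∷ Vec.replicate k′ (x , d))) ∎)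
        where
        xs = Vec.replicate k′ x
        inner : ∀ d → sumOver (Product D xs) (λ ds → density ((x , d) ∷ tokens xs ds)) ≡
                density ((x , d) ∷ Vec.replicate k′ (x , d))
        inner d = trans
          (sumOver-only (Product D xs) (λ ds → density ((x , d) ∷ tokens xs ds)) (proj₁ filled) off)
          (cong (λ Q → density ((x , d) ∷ Q)) (proj₂ filled))
          where
          filled = fill xs (Vec.replicate k′ (x , d)) (Vecₚ.map-replicate proj₁ (x , d) k′)
          off : ∀ ds → ds ≢ proj₁ filled → density ((x , d) ∷ tokens xs ds) ≡ 0#
          off ds ds≢ = density-conflict ((x , d) ∷ T) zero (suc i)
            (sym (trans (sym (lookup-vars T i)) (trans (cong (λ ys → Vec.lookup ys i) (vars-tokens xs ds)) (Vecₚ.lookup-replicate i x))))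
            (λ eq → T-i≢ (trans (sym eq) (sym (Vecₚ.lookup-replicate i (x , d)))))
            where
            T = tokens xs ds
            T≢ : T ≢ Vec.replicate k′ (x , d)
            T≢ eq = ds≢ (tokens-injective xs (trans eq (sym (proj₂ filled))))
            i = proj₁ (difference T _ T≢)
            T-i≢ = proj₂ (difference T _ T≢)

      identities : ∀ {m} → Vec X m → Vec (Constraint D) m
      identities = Vec.map identityConstraint

      lhs-identities : ∀ {m} (ys : Vec X m) → Vec.map lhs (identities ys) ≡ ys
      lhs-identities []       = refl
      lhs-identities (y ∷ ys) = cong (y ∷_) (lhs-identities ys)

      rhs-identities : ∀ {m} (ys : Vec X m) → Vec.map rhs (identities ys) ≡ ys
      rhs-identities []       = refl
      rhs-identities (y ∷ ys) = cong (y ∷_) (rhs-identities ys)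

      identities∈ : ∀ {m} (ys : Vec X m) → All (_∈ withIdentities 𝒟) (identities ys)
      identities∈ []       = []
      identities∈ (y ∷ ys) = identity∈ 𝒟 y ∷ identities∈ ys

      tokens-identities : ∀ {m} (ys : Vec X m) ds →
        tokens (Vec.map lhs (identities ys)) (productMap (identities ys) ds) ≡
        tokens (Vec.map rhs (identities ys)) ds
      tokens-identities []       []       = refl
      tokens-identities (y ∷ ys) (d ∷ ds) = cong ((y , d) ∷_) (tokens-identities ys ds)

      -- The type (1) constraint with `e` in the first slot and the added identities in all others;
      -- the identities force the remaining entries to be those of `P`.
      density-constraint : ∀ {e} → e ∈ constraints 𝒟 → ∀ d (P : Vec Token k′) →
        density ((lhs e , d) ∷ P) ≡
        pushforward (D (rhs e)) (D (lhs e)) (apply e) (λ a → density ((rhs e , a) ∷ P)) d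
      density-constraint {e} e∈ d P = begin
        density U                                       ≡⟨ cong density tokens-es ⟨
        density (tokens xs es)                          ≡⟨ density-tokens xs es ⟩
        μ xs es                                         ≡⟨ μ-constraint (productConstraint∈ 𝒟 (∈ₚ.∈-++⁺ˡ e∈ ∷ identities∈ (vars P))) es ⟩
        pushforward (Product D (rhs e ∷ ys)) (Product D xs) (productMap (e ∷ is)) (μ (rhs e ∷ ys)) es
                                                        ≡⟨ sumOver-∷ D (rhs e) ys g ⟩
        (sumOver (D (rhs e)) λ a → sumOver (Product D ys) λ ds → g (a ∷ ds))
                                                        ≡⟨ sumOver-cong (D (rhs e)) inner ⟩
        pushforward (D (rhs e)) (D (lhs e)) (apply e) (λ a → density ((rhs e , a) ∷ P)) d ∎
        where
        is = identities (vars P)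
        xs = Vec.map lhs (e ∷ is)
        ys = Vec.map rhs is
        U : Vec Token k
        U = (lhs e , d) ∷ P
        filled = fill xs U (cong (lhs e ∷_) (sym (lhs-identities (vars P))))
        es = proj₁ filled
        tokens-es = proj₂ filled
        filled′ = fill ys P (sym (rhs-identities (vars P)))
        ds₀ = proj₁ filled′
        tokens-ds₀ = proj₂ filled′
        g : Tuple (rhs e ∷ ys) → F
        g ds = if does (FinSet._≟_ (Product D xs) (productMap (e ∷ is) ds) es) then μ (rhs e ∷ ys) ds else 0#
        forth : ∀ a ds → productMap (e ∷ is) (a ∷ ds) ≡ es → (lhs e , apply e a) ∷ tokens ys ds ≡ U
        forth a ds eq = trans (cong ((lhs e , apply e a) ∷_) (sym (tokens-identities (vars P) ds)))
                              (trans (cong (tokens xs) eq) tokens-es)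
        back : ∀ a → apply e a ≡ d → productMap (e ∷ is) (a ∷ ds₀) ≡ es
        back a eq = tokens-injective xs (trans (cong₂ (λ b T → (lhs e , b) ∷ T) eq
          (trans (tokens-identities (vars P) ds₀) tokens-ds₀)) (sym tokens-es))
        heads : ∀ {a} {T T′ : Vec Token k′} → (lhs e , a) ∷ T ≡ (lhs e , d) ∷ T′ → a ≡ d
        heads refl = refl
        inner : ∀ a → sumOver (Product D ys) (λ ds → g (a ∷ ds)) ≡
                (if does (FinSet._≟_ (D (lhs e)) (apply e a) d) then density ((rhs e , a) ∷ P) else 0#)
        inner a = trans
          (sumOver-only (Product D ys) (λ ds → g (a ∷ ds)) ds₀ λ ds ds≢ →
            if-no (FinSet._≟_ (Product D xs) (productMap (e ∷ is) (a ∷ ds)) es) λ eq →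
              ds≢ (tokens-injective ys (trans (Vecₚ.∷-injectiveʳ (forth a ds eq)) (sym tokens-ds₀))))
          (if-⇔ (FinSet._≟_ (Product D xs) (productMap (e ∷ is) (a ∷ ds₀)) es) (FinSet._≟_ (D (lhs e)) (apply e a) d)
            (λ eq → heads (forth a ds₀ eq)) (back a)
            (trans (sym (density-tokens (rhs e ∷ ys) (a ∷ ds₀))) (cong (λ T → density ((rhs e , a) ∷ T)) tokens-ds₀)))

      pad : Token → List Token → ∀ m → Vec Token m
      pad t L       zero    = []
      pad t []      (suc m) = t ∷ pad t [] m
      pad t (s ∷ L) (suc m) = s ∷ pad t L m

      pad-∈ : ∀ t L m i → Vec.lookup (pad t L m) i ∈ t ∷ L
      pad-∈ t []      (suc m) zero    = here refl
      pad-∈ t []      (suc m) (suc i) = pad-∈ t [] m i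
      pad-∈ t (s ∷ L) (suc m) zero    = there (here refl)
      pad-∈ t (s ∷ L) (suc m) (suc i) with pad-∈ t L m i
      ... | here  eq = here eq
      ... | there s∈ = there (there s∈)

      ∈-pad : ∀ t L m {s} → List.length L ≤ m → s ∈ L → ∃ λ i → s ≡ Vec.lookup (pad t L m) i
      ∈-pad t (s ∷ L) (suc m) len       (here eq)  = zero , eq
      ∈-pad t (s ∷ L) (suc m) (s≤s len) (there s∈) with ∈-pad t L m len s∈
      ... | i , eq = suc i , eq

      pad-replicate : ∀ t m → pad t [] m ≡ Vec.replicate m t
      pad-replicate t zero    = refl
      pad-replicate t (suc m) = cong (t ∷_) (pad-replicate t m)

      -- Padding with the head of the list leaves the set of entries unchanged; truncation affects
      -- only lists longer than `k`.
      Ψ : List Token → F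
      Ψ []      = 1#
      Ψ (t ∷ L) = density (pad t (t ∷ L) k)

      Ψ-support : SupportInvariant k Ψ
      Ψ-support {[]}    {[]}     _   _    _    _    = refl
      Ψ-support {[]}    {t ∷ L}  _   _    _    L⊆L′ with () ← L⊆L′ (here refl)
      Ψ-support {t ∷ L} {[]}     _   _    L⊆L′ _    with () ← L⊆L′ (here refl)
      Ψ-support {t ∷ L} {t′ ∷ L′} len len′ L⊆L′ L′⊆L = density-support _ _
        (embed t L t′ L′ len′ L⊆L′) (embed t′ L′ t L len L′⊆L)
        where
        embed : ∀ t L t′ L′ → List.length (t′ ∷ L′) ≤ k → t ∷ L ⊆ t′ ∷ L′ →
                pad t (t ∷ L) k ≼ pad t′ (t′ ∷ L′) k
        embed t L t′ L′ len′ sub i with pad-∈ t (t ∷ L) k i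
        ... | here  eq = ∈-pad t′ (t′ ∷ L′) k len′ (sub (here eq))
        ... | there s∈ = ∈-pad t′ (t′ ∷ L′) k len′ (sub s∈)

      -- Padding with `t` instead of `s` makes the rest independent of `s`, so that statements about
      -- a varying first slot become applicable.
      Ψ-pad : ∀ s t L → List.length L < k′ → density (s ∷ pad t (t ∷ L) k′) ≡ Ψ (s ∷ t ∷ L)
      Ψ-pad s t L len = density-support _ _ forth back
        where
        full : List.length (s ∷ t ∷ L) ≤ k
        full = s≤s len
        forth : (s ∷ pad t (t ∷ L) k′) ≼ pad s (s ∷ t ∷ L) k
        forth zero    = zero , refl
        forth (suc i) with pad-∈ t (t ∷ L) k′ i
        ... | here  eq = ∈-pad s (s ∷ t ∷ L) k full (there (here eq))
        ... | there s∈ = ∈-pad s (s ∷ t ∷ L) k full (there s∈)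
        inside : ∀ {u} → u ∈ s ∷ t ∷ L → ∃ λ j → u ≡ Vec.lookup (s ∷ pad t (t ∷ L) k′) j
        inside (here eq)  = zero , eq
        inside (there u∈) with ∈-pad t (t ∷ L) k′ len u∈
        ... | j , eq = suc j , eq
        back : pad s (s ∷ t ∷ L) k ≼ (s ∷ pad t (t ∷ L) k′)
        back i with pad-∈ s (s ∷ t ∷ L) k i
        ... | here  eq = zero , eq
        ... | there u∈ = inside u∈

      Ψ-sum : ∀ x L → List.length L < k → sumOver (D x) (λ d → Ψ ((x , d) ∷ L)) ≡ Ψ L
      Ψ-sum x [] _ = trans
        (sumOver-cong (D x) λ d → cong (λ T → density ((x , d) ∷ T)) (pad-replicate (x , d) k′))
        (density-diagonal x)
      Ψ-sum x (t ∷ L) (s≤s len) = begin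
        sumOver (D x) (λ d → Ψ ((x , d) ∷ t ∷ L))       ≡⟨ sumOver-cong (D x) (λ d → Ψ-pad (x , d) t L len) ⟨
        sumOver (D x) (λ d → density ((x , d) ∷ P))     ≡⟨ density-marginal x P zero ⟩
        density (t ∷ P)                                 ≡⟨ Ψ-pad t t L len ⟩
        Ψ (t ∷ t ∷ L)                                   ≡⟨ Ψ-support (s≤s len) (ℕₚ.≤-trans len (ℕₚ.n≤1+n k′)) contract there ⟩
        Ψ (t ∷ L)                                       ∎
        where
        P = pad t (t ∷ L) k′
        contract : t ∷ t ∷ L ⊆ t ∷ L
        contract (here eq)  = here eq
        contract (there s∈) = s∈

      Ψ-constraint : ∀ {e} → e ∈ constraints 𝒟 → ∀ d L → List.length L < k →
        Ψ ((lhs e , d) ∷ L) ≡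
        pushforward (D (rhs e)) (D (lhs e)) (apply e) (λ a → Ψ ((rhs e , a) ∷ L)) d
      Ψ-constraint {e} e∈ d (t ∷ L) (s≤s len) = begin
        Ψ ((lhs e , d) ∷ t ∷ L)                         ≡⟨ Ψ-pad (lhs e , d) t L len ⟨
        density ((lhs e , d) ∷ P)                       ≡⟨ density-constraint e∈ d P ⟩
        pushforward (D (rhs e)) (D (lhs e)) (apply e) (λ a → density ((rhs e , a) ∷ P)) d
          ≡⟨ pushforward-cong (D (rhs e)) (D (lhs e)) (apply e) (λ a → Ψ-pad (rhs e , a) t L len) d ⟩
        pushforward (D (rhs e)) (D (lhs e)) (apply e) (λ a → Ψ ((rhs e , a) ∷ t ∷ L)) d ∎
        where P = pad t (t ∷ L) k′
      -- A single token is padded with copies of itself, so the constraint cannot be applied to one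
      -- slot alone. A second token at `y` is summed in, serves as the rest for the case above, and
      -- is summed out again; both tokens fit because `k` is at least 2.
      Ψ-constraint {e} e∈ d [] _ = begin
        Ψ ((x , d) ∷ [])                                ≡⟨ Ψ-sum y ((x , d) ∷ []) (s≤s (s≤s z≤n)) ⟨
        sumOver (D y) (λ b → Ψ ((y , b) ∷ (x , d) ∷ []))
          ≡⟨ sumOver-cong (D y) (λ b → trans (swap (y , b) (x , d)) (Ψ-constraint e∈ d ((y , b) ∷ []) (s≤s (s≤s z≤n)))) ⟩
        (sumOver (D y) λ b → sumOver (D y) λ a → if hits a then Ψ ((y , a) ∷ (y , b) ∷ []) else 0#)
          ≡⟨ sumOver-swap (D y) (D y) (λ b a → if hits a then Ψ ((y , a) ∷ (y , b) ∷ []) else 0#) ⟩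
        (sumOver (D y) λ a → sumOver (D y) λ b → if hits a then Ψ ((y , a) ∷ (y , b) ∷ []) else 0#)
          ≡⟨ sumOver-cong (D y) (λ a → pull (hits a) a) ⟩
        pushforward (D y) (D x) (apply e) (λ a → Ψ ((y , a) ∷ [])) d ∎
        where
        x = lhs e
        y = rhs e
        hits : ∣ D y ∣ → Bool
        hits a = does (FinSet._≟_ (D x) (apply e a) d)
        swap : ∀ s t → Ψ (s ∷ t ∷ []) ≡ Ψ (t ∷ s ∷ [])
        swap s t = Ψ-support (s≤s (s≤s z≤n)) (s≤s (s≤s z≤n)) exchange exchange
          where
          exchange : ∀ {s t} → s ∷ t ∷ [] ⊆ t ∷ s ∷ []
          exchange (here eq)         = there (here eq)
          exchange (there (here eq)) = here eq
        pull : ∀ h a → sumOver (D y) (λ b → if h then Ψ ((y , a) ∷ (y , b) ∷ []) else 0#) ≡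
               (if h then Ψ ((y , a) ∷ []) else 0#)
        pull true  a = trans (sumOver-cong (D y) λ b → swap (y , a) (y , b)) (Ψ-sum y ((y , a) ∷ []) (s≤s (s≤s z≤n)))
        pull false a = sumOver-zero (D y) λ _ → refl

      moments : Moments k
      moments = record
        { Ψ = Ψ ; Ψ-[] = refl ; Ψ-support = Ψ-support ; Ψ-sum = Ψ-sum ; Ψ-constraint = Ψ-constraint
        ; Ψ-conflict = λ { {x} {d} {d′} L d≢d′ →
            density-conflict (pad (x , d) ((x , d) ∷ (x , d′) ∷ L) k) zero (suc zero) refl (λ { refl → d≢d′ refl }) }
        }

-- Vectors with the given moments, their span, and the axioms (s), (o) and (p).

module Vectors (𝔽 : PrimeField) (𝒟 : LC) {k″ : ℕ} (moments : Moment.Moments 𝔽 𝒟 (suc (suc k″))) where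

  open Linear 𝔽
  open Points 𝔽
  open FiniteSums 𝔽
  open Realisation 𝔽
  open Tuples (Dom 𝒟)
  open Moment.Moments moments
  open ≡-Reasoning

  private
    D = Dom 𝒟

    -- One less than the exponent of the power: the bound on the length of test lists.
    k : ℕ
    k = suc k″

  allTokens : List Token
  allTokens = List.concat (List.map (λ x → List.map (x ,_) (elements (D x))) (elements (Var 𝒟)))

  ∈-allTokens : ∀ t → t ∈ allTokens
  ∈-allTokens (x , d) = ∈ₚ.∈-concat⁺′ (∈ₚ.∈-map⁺ (x ,_) (∈-elements (D x) d))
    (∈ₚ.∈-map⁺ (λ x → List.map (x ,_) (elements (D x))) (∈-elements (Var 𝒟) x))

  n : ℕ
  n = List.length allTokens

  token : Fin n → Token
  token = List.lookup allTokens

  index : Token → Fin n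
  index t = ListAny.index (∈-allTokens t)

  token-index : ∀ t → token (index t) ≡ t
  token-index t = sym (lookup-index (∈-allTokens t))

  Φ : List (Fin n) → F
  Φ = Ψ ∘ List.map token

  Φ-support : SupportInvariant (suc k) Φ
  Φ-support {L} {L′} len len′ L⊆L′ L′⊆L = Ψ-support
    (subst (_≤ suc k) (sym (Listₚ.length-map token L)) len)
    (subst (_≤ suc k) (sym (Listₚ.length-map token L′)) len′)
    (⊆ₚ.map⁺ token L⊆L′) (⊆ₚ.map⁺ token L′⊆L)

  -- The common shape of (s) and of the constraints: the coordinates `f a` selected by `h` add up to
  -- coordinate `t`. For (s) the target is the constant coordinate zero.
  relation : (A : FinSet) → (∣ A ∣ → Bool) → (∣ A ∣ → Fin (suc n)) → Fin (suc n) → Vector F (suc n)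
  relation A h f t q = sumOver A (λ a → if h a then δ (f a) q else 0#) + (- 1#) * δ t q

  relation-· : ∀ A h f t E → relation A h f t · E ≡
               sumOver A (λ a → if h a then E (f a) else 0#) + - E t
  relation-· A h f t E = begin
    relation A h f t · E
      ≡⟨ ·-+ˡ (λ q → sumOver A (λ a → term a q)) (λ q → (- 1#) * δ t q) E ⟩
    (λ q → sumOver A (λ a → term a q)) · E + (λ q → (- 1#) * δ t q) · E
      ≡⟨ cong₂ _+_ positive negative ⟩
    sumOver A (λ a → if h a then E (f a) else 0#) + - E t ∎
    where
    term : ∣ A ∣ → Vector F (suc n)
    term a q = if h a then δ (f a) q else 0#
    choose : ∀ b a → sum (λ q → (if b then δ (f a) q else 0#) * E q) ≡ (if b then E (f a) else 0#)
    choose true  a = δ-· (f a) E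
    choose false a = ·-zeroˡ E λ _ → refl
    positive : (λ q → sumOver A (λ a → term a q)) · E ≡ sumOver A (λ a → if h a then E (f a) else 0#)
    positive = begin
      sum (λ q → sumOver A (λ a → term a q) * E q)      ≡⟨ sum-cong-≗ (λ q → sumOver-*ʳ A (λ a → term a q) (E q)) ⟨
      sum (λ q → sumOver A (λ a → term a q * E q))      ≡⟨ ∑-comm (λ q i → term (FinSet.from A i) q * E q) ⟩
      sumOver A (λ a → term a · E)                      ≡⟨ sumOver-cong A (λ a → choose (h a) a) ⟩
      sumOver A (λ a → if h a then E (f a) else 0#)     ∎
    negative : (λ q → (- 1#) * δ t q) · E ≡ - E t
    negative = begin
      (λ q → (- 1#) * δ t q) · E    ≡⟨ ·-*ˡ (- 1#) (δ t) E ⟩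
      (- 1#) * (δ t · E)            ≡⟨ cong ((- 1#) *_) (δ-· t E) ⟩
      (- 1#) * E t                  ≡⟨ -1*x≈-x (E t) ⟩
      - E t                         ∎

  sumRelation : ∣ Var 𝒟 ∣ → Vector F (suc n)
  sumRelation x = relation (D x) (λ _ → true) (λ d → suc (index (x , d))) zero

  hits : (e : Constraint D) → ∣ D (lhs e) ∣ → ∣ D (rhs e) ∣ → Bool
  hits e d a = does (FinSet._≟_ (D (lhs e)) (apply e a) d)

  constraintRelation : (e : Constraint D) → ∣ D (lhs e) ∣ → Vector F (suc n)
  constraintRelation e d = relation (D (rhs e)) (hits e d) (λ a → suc (index (rhs e , a))) (suc (index (lhs e , d)))

  constraintRelations : Constraint D → List (Vector F (suc n))
  constraintRelations e = List.map (constraintRelation e) (elements (D (lhs e)))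

  relations : List (Vector F (suc n))
  relations = List.map sumRelation (elements (Var 𝒟)) ++ List.concat (List.map constraintRelations (constraints 𝒟))

  extend : List (Fin n) → Vector F (suc n)
  extend = extension k Φ Φ-support Ψ-[]

  Φ-∷ : ∀ t L → Φ (index t ∷ L) ≡ Ψ (t ∷ List.map token L)
  Φ-∷ t L = cong (λ s → Ψ (s ∷ List.map token L)) (token-index t)

  Annihilated : Vector F (suc n) → Set
  Annihilated r = ∀ L → List.length L ≤ k → r · extend L ≡ 0#

  short : ∀ (L : List (Fin n)) → List.length L ≤ k → List.length (List.map token L) < suc k
  short L len = s≤s (subst (_≤ k) (sym (Listₚ.length-map token L)) len)

  sumRelation-annihilated : ∀ x → Annihilated (sumRelation x)
  sumRelation-annihilated x L len = trans (relation-· (D x) (λ _ → true) (λ d → suc (index (x , d))) zero (extend L)) (x≈y⇒x-y≈0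
    (trans (sumOver-cong (D x) λ d → Φ-∷ (x , d) L) (Ψ-sum x (List.map token L) (short L len))))

  constraintRelation-annihilated : ∀ {e} → e ∈ constraints 𝒟 → ∀ d → Annihilated (constraintRelation e d)
  constraintRelation-annihilated {e} e∈ d L len =
    trans (relation-· (D (rhs e)) (hits e d) (λ a → suc (index (rhs e , a))) (suc (index (lhs e , d))) (extend L)) (x≈y⇒x-y≈0 (begin
      sumOver (D (rhs e)) (λ a → if hits e d a then Φ (index (rhs e , a) ∷ L) else 0#)
        ≡⟨ sumOver-cong (D (rhs e)) (λ a → cong (λ x → if hits e d a then x else 0#) (Φ-∷ (rhs e , a) L)) ⟩
      sumOver (D (rhs e)) (λ a → if hits e d a then Ψ ((rhs e , a) ∷ List.map token L) else 0#)
        ≡⟨ Ψ-constraint e∈ d (List.map token L) (short L len) ⟨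
      Ψ ((lhs e , d) ∷ List.map token L)      ≡⟨ Φ-∷ (lhs e , d) L ⟨
      Φ (index (lhs e , d) ∷ L)               ∎))

  annihilated : ListAll.All Annihilated relations
  annihilated = ListAllₚ.++⁺
    (ListAllₚ.map⁺ (ListAll.universal sumRelation-annihilated (elements (Var 𝒟))))
    (ListAllₚ.concat⁺ (ListAllₚ.map⁺ (ListAll.tabulate λ {e} e∈ →
      ListAllₚ.map⁺ (ListAll.universal (constraintRelation-annihilated e∈) (elements (D (lhs e)))))))

  private
    realised = realise k Φ Φ-support Ψ-[] relations annihilated

  N : ℕ
  N = proj₁ realised

  v : Token → Vector F N
  v t = proj₁ (proj₂ realised) (index t)

  sum-monomial-v : ∀ L → List.length L ≤ suc k → sum (monomial v L) ≡ Ψ L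
  sum-monomial-v L len = begin
    sum (monomial v L)                        ≡⟨ sum-cong-≗ (monomial-index L) ⟩
    sum (monomial y (List.map index L))       ≡⟨ proj₁ (proj₂ (proj₂ realised)) (List.map index L)
                                                   (subst (_≤ suc k) (sym (Listₚ.length-map index L)) len) ⟩
    Ψ (List.map token (List.map index L))     ≡⟨ cong Ψ (tokens-indices L) ⟩
    Ψ L                                       ∎
    where
    y = proj₁ (proj₂ realised)
    monomial-index : ∀ L → monomial v L ≗ monomial y (List.map index L)
    monomial-index []      j = refl
    monomial-index (t ∷ L) j = cong (v t j *_) (monomial-index L j)
    tokens-indices : ∀ L → List.map token (List.map index L) ≡ L
    tokens-indices []      = refl
    tokens-indices (t ∷ L) = cong₂ _∷_ (token-index t) (tokens-indices L)

  private
    exact : ∀ {r} → r ∈ relations → ∀ j → r · (1# ◂ λ s → proj₁ (proj₂ realised) s j) ≡ 0#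
    exact r∈ = ListAll.lookup (proj₂ (proj₂ (proj₂ realised))) r∈

  v-sum : ∀ x j → sumOver (D x) (λ d → v (x , d) j) ≡ 1#
  v-sum x j = x-y≈0⇒x≈y _ _ (trans
    (sym (relation-· (D x) (λ _ → true) (λ d → suc (index (x , d))) zero (1# ◂ λ s → proj₁ (proj₂ realised) s j)))
    (exact (∈ₚ.∈-++⁺ˡ (∈ₚ.∈-map⁺ sumRelation (∈-elements (Var 𝒟) x))) j))

  v-constraint : ∀ {e} → e ∈ constraints 𝒟 → ∀ d j → v (lhs e , d) j ≡
                 pushforward (D (rhs e)) (D (lhs e)) (apply e) (λ a → v (rhs e , a) j) d
  v-constraint {e} e∈ d j = sym (x-y≈0⇒x≈y _ _ (trans
    (sym (relation-· (D (rhs e)) (hits e d) (λ a → suc (index (rhs e , a))) (suc (index (lhs e , d)))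
           (1# ◂ λ s → proj₁ (proj₂ realised) s j)))
    (exact (∈ₚ.∈-++⁺ʳ (List.map sumRelation (elements (Var 𝒟)))
      (∈ₚ.∈-concat⁺′ (∈ₚ.∈-map⁺ (constraintRelation e) (∈-elements (D (lhs e)) d))
                     (∈ₚ.∈-map⁺ constraintRelations e∈))) j)))

  product : ∀ {m} → Vec (Vector F N) m → Vector F N
  product = Vec.foldr′ _∙_ (λ _ → 1#)

  -- Membership is a derivation, so claims about all vectors of the span are proved by induction;
  -- invariance under `≗` has to be a constructor because vectors are functions.
  data Span : Vector F N → Set where
    generator : ∀ t → Span (v t)
    ≗-span    : ∀ {u w} → u ≗ w → Span u → Span w
    0-span    : Span (λ _ → 0#)
    +-span    : ∀ {u w} → Span u → Span w → Span (λ j → u j + w j)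
    *-span    : ∀ x {u} → Span u → Span (λ j → x * u j)

  Null : ℕ → Vector F N → Set
  Null m z = ∀ L → List.length L ≤ m → sum (z ∙ monomial v L) ≡ 0#

  -- The claim is linear in `u`, and a generator simply occupies one of the `suc m` places.
  -- Iterated, this extends (o) and (p) from generators to the whole span.
  null-∙ : ∀ {m z u} → Null (suc m) z → Span u → Null m (z ∙ u)
  null-∙ {z = z} z-null (generator t) L len =
    trans (sum-cong-≗ λ j → *-assoc (z j) (v t j) (monomial v L j)) (z-null (t ∷ L) (s≤s len))
  null-∙ {z = z} z-null (≗-span {u} u≗w u∈) L len =
    trans (sum-cong-≗ λ j → cong (λ x → (z j * x) * monomial v L j) (sym (u≗w j))) (null-∙ z-null u∈ L len)
  null-∙ {z = z} z-null 0-span L len =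
    sum-zero λ j → trans (cong (_* monomial v L j) (zeroʳ (z j))) (zeroˡ (monomial v L j))
  null-∙ {z = z} z-null (+-span {u} {w} u∈ w∈) L len = begin
    sum (λ j → (z j * (u j + w j)) * y j)                         ≡⟨ sum-cong-≗ (λ j → trans (cong (_* y j) (distribˡ (z j) (u j) (w j))) (distribʳ (y j) (z j * u j) (z j * w j))) ⟩
    sum (λ j → ((z ∙ u) ∙ y) j + ((z ∙ w) ∙ y) j)                 ≡⟨ ∑-distrib-+ ((z ∙ u) ∙ y) ((z ∙ w) ∙ y) ⟩
    sum ((z ∙ u) ∙ y) + sum ((z ∙ w) ∙ y)                         ≡⟨ cong₂ _+_ (null-∙ z-null u∈ L len) (null-∙ z-null w∈ L len) ⟩
    0# + 0#                                                       ≡⟨ +-identityˡ 0# ⟩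
    0#                                                            ∎
    where y = monomial v L
  null-∙ {z = z} z-null (*-span x {u} u∈) L len = begin
    sum (λ j → (z j * (x * u j)) * y j)      ≡⟨ sum-cong-≗ (λ j → trans (cong (_* y j) (x∙yz≈y∙xz (z j) x (u j))) (*-assoc x (z j * u j) (y j))) ⟩
    sum (λ j → x * ((z ∙ u) ∙ y) j)          ≡⟨ *-distribˡ-sum x ((z ∙ u) ∙ y) ⟨
    x * sum ((z ∙ u) ∙ y)                    ≡⟨ cong (x *_) (null-∙ z-null u∈ L len) ⟩
    x * 0#                                   ≡⟨ zeroʳ x ⟩
    0#                                       ∎
    where y = monomial v L

  null-product : ∀ {m z} → Null m z → {us : Vec (Vector F N) m} → All Span us → sum (z ∙ product us) ≡ 0#
  null-product         z-null []                    = z-null [] z≤n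
  null-product {z = z} z-null {u ∷ us} (u∈ ∷ us∈) =
    trans (sum-cong-≗ λ j → sym (*-assoc (z j) (u j) (product us j)))
          (null-product {z = z ∙ u} (null-∙ {z = z} {u = u} z-null u∈) us∈)

  v-orthogonal : ∀ x {a b} → a ≢ b → {us : Vec (Vector F N) k″} → All Span us →
                 sum (v (x , a) ∙ v (x , b) ∙ product us) ≡ 0#
  v-orthogonal x {a} {b} a≢b {us} us∈ = begin
    sum (v (x , a) ∙ v (x , b) ∙ product us)     ≡⟨ sum-cong-≗ (λ j → *-assoc (v (x , a) j) (v (x , b) j) (product us j)) ⟨
    sum ((v (x , a) ∙ v (x , b)) ∙ product us)   ≡⟨ null-product {z = v (x , a) ∙ v (x , b)} null us∈ ⟩
    0#                                           ∎
    where
    null : Null k″ (v (x , a) ∙ v (x , b))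
    null L len = begin
      sum ((v (x , a) ∙ v (x , b)) ∙ monomial v L)   ≡⟨ sum-cong-≗ (λ j → *-assoc (v (x , a) j) (v (x , b) j) (monomial v L j)) ⟩
      sum (monomial v ((x , a) ∷ (x , b) ∷ L))       ≡⟨ sum-monomial-v ((x , a) ∷ (x , b) ∷ L) (s≤s (s≤s len)) ⟩
      Ψ ((x , a) ∷ (x , b) ∷ L)                      ≡⟨ Ψ-conflict L a≢b ⟩
      0#                                             ∎

  -- As a vanishing statement about the difference `z` of the square of `v t` and `v t`, this has
  -- the form `null-product` treats; on generators it holds since a repeated token does not change
  -- the set of entries.
  v-idempotent : ∀ t {us : Vec (Vector F N) k″} → All Span us →
                 sum (v t ∙ v t ∙ product us) ≡ sum (v t ∙ product us)
  v-idempotent t {us} us∈ = x-y≈0⇒x≈y _ _ (trans (sym (difference (product us))) (null-product {z = z} null us∈))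
    where
    z : Vector F N
    z j = v t j * v t j + (- 1#) * v t j
    difference : ∀ w → sum (z ∙ w) ≡ sum (v t ∙ v t ∙ w) + - sum (v t ∙ w)
    difference w = begin
      sum (z ∙ w)
        ≡⟨ sum-cong-≗ (λ j → trans (distribʳ (w j) (v t j * v t j) ((- 1#) * v t j))
             (cong₂ _+_ (*-assoc (v t j) (v t j) (w j)) (*-assoc (- 1#) (v t j) (w j)))) ⟩
      sum (λ j → (v t ∙ v t ∙ w) j + (- 1#) * (v t ∙ w) j)
        ≡⟨ ∑-distrib-+ (v t ∙ v t ∙ w) (λ j → (- 1#) * (v t ∙ w) j) ⟩
      sum (v t ∙ v t ∙ w) + sum (λ j → (- 1#) * (v t ∙ w) j)
        ≡⟨ cong (sum (v t ∙ v t ∙ w) +_) (trans (sym (*-distribˡ-sum (- 1#) (v t ∙ w))) (-1*x≈-x (sum (v t ∙ w)))) ⟩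
      sum (v t ∙ v t ∙ w) + - sum (v t ∙ w) ∎
    null : Null k″ z
    null L len = trans (difference (monomial v L)) (x≈y⇒x-y≈0 (begin
      sum (monomial v (t ∷ t ∷ L))     ≡⟨ sum-monomial-v (t ∷ t ∷ L) (s≤s (s≤s len)) ⟩
      Ψ (t ∷ t ∷ L)                    ≡⟨ Ψ-support (s≤s (s≤s len)) (s≤s (ℕₚ.m≤n⇒m≤1+n len)) contract there ⟩
      Ψ (t ∷ L)                        ≡⟨ sum-monomial-v (t ∷ L) (s≤s (ℕₚ.m≤n⇒m≤1+n len)) ⟨
      sum (monomial v (t ∷ L))         ∎))
      where
      contract : t ∷ t ∷ L ⊆ t ∷ L
      contract (here eq)  = here eq
      contract (there s∈) = s∈

-- A solution of the saturated power from vectors in a common space.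

tuples-∈ : ∀ {A : Set} (xs : List A) k {v : Vec A k} → v ∈ tuples xs k → All (_∈ xs) v
tuples-∈ xs zero    (here refl) = []
tuples-∈ xs (suc k) v∈ with ∈ₚ.∈-cartesianProductWith⁻ _∷_ xs (tuples xs k) v∈
... | _ , _ , x∈ , w∈ , refl = x∈ ∷ tuples-∈ xs k w∈

module PowerSolution (𝔽 : PrimeField) (𝒟 : LC) (k″ : ℕ) where

  open Linear 𝔽
  open FiniteSums 𝔽
  open Tuples (Dom 𝒟)
  open ≡-Reasoning

  private
    X = ∣ Var 𝒟 ∣
    D = Dom 𝒟

  module FromVectors
    {N : ℕ} (Member : Vector F N → Set)
    (v : ∀ x → ∣ D x ∣ → Vector F N)
    (v∈ : ∀ x d → Member (v x d))
    (1∈ : Member (λ _ → 1#))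
    (total : sum {N} (λ _ → 1#) ≡ 1#)
    (v-sum : ∀ x j → sumOver (D x) (λ d → v x d j) ≡ 1#)
    (v-orthogonal : ∀ x {d d′} → d ≢ d′ → (us : Vec (Vector F N) k″) → All Member us →
       sum (v x d ∙ v x d′ ∙ Vec.foldr′ _∙_ (λ _ → 1#) us) ≡ 0#)
    (v-idempotent : ∀ x d (us : Vec (Vector F N) k″) → All Member us →
       sum (v x d ∙ v x d ∙ Vec.foldr′ _∙_ (λ _ → 1#) us) ≡ sum (v x d ∙ Vec.foldr′ _∙_ (λ _ → 1#) us))
    (v-constraint : ∀ {e} → e ∈ constraints 𝒟 → ∀ d j → v (lhs e) d j ≡
       pushforward (D (rhs e)) (D (lhs e)) (apply e) (λ a → v (rhs e) a j) d)
    where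

    private
      𝟏 : Vector F N
      𝟏 _ = 1#

      k : ℕ
      k = suc (suc k″)

      product : ∀ {m} → Vec (Vector F N) m → Vector F N
      product = Vec.foldr′ _∙_ 𝟏

    vectors : ∀ {m} (xs : Vec X m) → Tuple xs → Vector F N
    vectors []       []       = 𝟏
    vectors (x ∷ xs) (d ∷ ds) = v x d ∙ vectors xs ds

    density : ∀ {m} (xs : Vec X m) → Tuple xs → F
    density xs ds = sum (vectors xs ds)

    sum-swap : ∀ (u w z : Vector F N) → sum ((u ∙ w) ∙ z) ≡ sum (w ∙ (u ∙ z))
    sum-swap u w z = sum-cong-≗ λ j → xy∙z≈y∙xz (u j) (w j) (z j)

    sum-assoc : ∀ (u w z : Vector F N) → sum ((u ∙ w) ∙ z) ≡ sum (u ∙ (w ∙ z))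
    sum-assoc u w z = sum-cong-≗ λ j → *-assoc (u j) (w j) (z j)

    sum-v : ∀ x (w : Vector F N) → sumOver (D x) (λ d → sum (v x d ∙ w)) ≡ sum w
    sum-v x w = begin
      sumOver (D x) (λ d → sum (v x d ∙ w))           ≡⟨ ∑-comm (λ i j → v x (FinSet.from (D x) i) j * w j) ⟩
      sum (λ j → sumOver (D x) (λ d → v x d j * w j)) ≡⟨ sum-cong-≗ (λ j → sumOver-*ʳ (D x) (λ d → v x d j) (w j)) ⟩
      sum (λ j → sumOver (D x) (λ d → v x d j) * w j) ≡⟨ sum-cong-≗ (λ j → trans (cong (_* w j) (v-sum x j)) (*-identityˡ (w j))) ⟩
      sum w                                           ∎

    sum-vectors : ∀ {m} (xs : Vec X m) z → sumOver (Product D xs) (λ ds → sum (vectors xs ds ∙ z)) ≡ sum z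
    sum-vectors [] z = trans
      (sumOver-only (Product D []) (λ ds → sum (vectors [] ds ∙ z)) [] λ { [] ds≢ → contradiction refl ds≢ })
      (sum-cong-≗ λ j → *-identityˡ (z j))
    sum-vectors (x ∷ xs) z = begin
      sumOver (Product D (x ∷ xs)) (λ ds → sum (vectors (x ∷ xs) ds ∙ z))
        ≡⟨ sumOver-∷ D x xs (λ ds → sum (vectors (x ∷ xs) ds ∙ z)) ⟩
      (sumOver (D x) λ d → sumOver (Product D xs) λ ds → sum ((v x d ∙ vectors xs ds) ∙ z))
        ≡⟨ sumOver-cong (D x) (λ d → sumOver-cong (Product D xs) λ ds → sum-swap (v x d) (vectors xs ds) z) ⟩
      (sumOver (D x) λ d → sumOver (Product D xs) λ ds → sum (vectors xs ds ∙ (v x d ∙ z)))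
        ≡⟨ sumOver-cong (D x) (λ d → sum-vectors xs (v x d ∙ z)) ⟩
      sumOver (D x) (λ d → sum (v x d ∙ z))
        ≡⟨ sum-v x z ⟩
      sum z ∎

    density-sum : ∀ {m} (xs : Vec X m) → sumOver (Product D xs) (density xs) ≡ 1#
    density-sum xs = begin
      sumOver (Product D xs) (density xs)
        ≡⟨ sumOver-cong (Product D xs) (λ ds → sum-cong-≗ λ j → *-identityʳ (vectors xs ds j)) ⟨
      sumOver (Product D xs) (λ ds → sum (vectors xs ds ∙ 𝟏))
        ≡⟨ sum-vectors xs 𝟏 ⟩
      sum 𝟏
        ≡⟨ total ⟩
      1# ∎

    Consistent : Constraint D → Set
    Consistent e = ∀ d j → v (lhs e) d j ≡
      pushforward (D (rhs e)) (D (lhs e)) (apply e) (λ a → v (rhs e) a j) d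

    withIdentities-consistent : ∀ {e} → e ∈ withIdentities 𝒟 → Consistent e
    withIdentities-consistent e∈ with ∈ₚ.∈-++⁻ (constraints 𝒟) e∈
    ... | inj₁ e∈𝒟 = v-constraint e∈𝒟
    ... | inj₂ e∈id with ∈ₚ.∈-map⁻ identityConstraint e∈id
    ... | x , _ , refl = λ d j → sym (begin
      pushforward (D x) (D x) id (λ a → v x a j) d
        ≡⟨ sumOver-only (D x) _ d (λ a a≢d → if-no (FinSet._≟_ (D x) a d) a≢d) ⟩
      (if does (FinSet._≟_ (D x) d d) then v x d j else 0#)
        ≡⟨ if-yes (FinSet._≟_ (D x) d d) refl ⟩
      v x d j ∎)

    if-× : ∀ {A B C : Set} (A? : Dec A) (B? : Dec B) (C? : Dec C) → (C → A) → (C → B) → (A → B → C) → ∀ x →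
           (if does A? then (if does B? then x else 0#) else 0#) ≡ (if does C? then x else 0#)
    if-× (yes a) (yes b) C? f g h x = sym (if-yes C? (h a b))
    if-× (yes a) (no ¬b) C? f g h x = sym (if-no C? (¬b ∘ g))
    if-× (no ¬a) B?      C? f g h x = sym (if-no C? (¬a ∘ f))

    if-*ʳ : ∀ b (x y : F) → (if b then x else 0#) * y ≡ (if b then x * y else 0#)
    if-*ʳ true  x y = refl
    if-*ʳ false x y = zeroˡ y

    *-if : ∀ b (x y : F) → x * (if b then y else 0#) ≡ (if b then x * y else 0#)
    *-if true  x y = refl
    *-if false x y = zeroʳ x

    -- At each coordinate, a product of fibre sums is the sum over the product of the fibres, by
    -- distributivity.
    vectors-product : ∀ {m} {es : Vec (Constraint D) m} → All Consistent es → ∀ ds j →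
      vectors (Vec.map lhs es) ds j ≡
      pushforward (Product D (Vec.map rhs es)) (Product D (Vec.map lhs es)) (productMap es)
        (λ ds′ → vectors (Vec.map rhs es) ds′ j) ds
    vectors-product {es = []} [] [] j = sym (trans
      (sumOver-only (Product D []) f [] λ { [] ds≢ → contradiction refl ds≢ })
      (if-yes (FinSet._≟_ (Product D []) [] []) {1#} {0#} refl))
      where
      f : Tuple [] → F
      f as = if does (FinSet._≟_ (Product D []) (productMap {Dom = D} [] as) []) then vectors [] as j else 0#
    vectors-product {es = e ∷ es} (c ∷ cs) (d ∷ ds) j = sym (begin
      pushforward (Product D (rhs e ∷ ys)) (Product D (lhs e ∷ xs)) (productMap (e ∷ es))
        (λ as → vectors (rhs e ∷ ys) as j) (d ∷ ds)
        ≡⟨ sumOver-∷ D (rhs e) ys h ⟩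
      (sumOver (D (rhs e)) λ a → sumOver (Product D ys) λ as →
        if does (FinSet._≟_ (Product D (lhs e ∷ xs)) (apply e a ∷ productMap es as) (d ∷ ds))
        then v (rhs e) a j * vectors ys as j else 0#)
        ≡⟨ sumOver-cong (D (rhs e)) (λ a → sumOver-cong (Product D ys) λ as → sym (split a as)) ⟩
      (sumOver (D (rhs e)) λ a → sumOver (Product D ys) λ as → f a * g as)
        ≡⟨ sumOver-cong (D (rhs e)) (λ a → sumOver-*ˡ (Product D ys) (f a) g) ⟩
      (sumOver (D (rhs e)) λ a → f a * sumOver (Product D ys) g)
        ≡⟨ sumOver-*ʳ (D (rhs e)) f (sumOver (Product D ys) g) ⟩
      sumOver (D (rhs e)) f * sumOver (Product D ys) g
        ≡⟨ cong₂ _*_ (c d j) (vectors-product cs ds j) ⟨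
      v (lhs e) d j * vectors xs ds j ∎)
      where
      xs = Vec.map lhs es
      ys = Vec.map rhs es
      f : ∣ D (rhs e) ∣ → F
      f a = if does (FinSet._≟_ (D (lhs e)) (apply e a) d) then v (rhs e) a j else 0#
      g : Tuple ys → F
      g as = if does (FinSet._≟_ (Product D xs) (productMap es as) ds) then vectors ys as j else 0#
      h : Tuple (rhs e ∷ ys) → F
      h as = if does (FinSet._≟_ (Product D (lhs e ∷ xs)) (productMap (e ∷ es) as) (d ∷ ds))
             then vectors (rhs e ∷ ys) as j else 0#
      split : ∀ a as → f a * g as ≡
        (if does (FinSet._≟_ (Product D (lhs e ∷ xs)) (apply e a ∷ productMap es as) (d ∷ ds))
         then v (rhs e) a j * vectors ys as j else 0#)
      split a as = begin
        f a * g as      ≡⟨ if-*ʳ (does (FinSet._≟_ (D (lhs e)) (apply e a) d)) (v (rhs e) a j) (g as) ⟩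
        (if does (FinSet._≟_ (D (lhs e)) (apply e a) d) then v (rhs e) a j * g as else 0#)
          ≡⟨ cong (λ x → if does (FinSet._≟_ (D (lhs e)) (apply e a) d) then x else 0#)
               (*-if (does (FinSet._≟_ (Product D xs) (productMap es as) ds)) (v (rhs e) a j) (vectors ys as j)) ⟩
        (if does (FinSet._≟_ (D (lhs e)) (apply e a) d) then
          (if does (FinSet._≟_ (Product D xs) (productMap es as) ds) then v (rhs e) a j * vectors ys as j else 0#) else 0#)
          ≡⟨ if-× (FinSet._≟_ (D (lhs e)) (apply e a) d) (FinSet._≟_ (Product D xs) (productMap es as) ds)
               (FinSet._≟_ (Product D (lhs e ∷ xs)) (apply e a ∷ productMap es as) (d ∷ ds))
               (cong VecAll.head) (cong VecAll.tail) (cong₂ _∷_) (v (rhs e) a j * vectors ys as j) ⟩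
        (if does (FinSet._≟_ (Product D (lhs e ∷ xs)) (apply e a ∷ productMap es as) (d ∷ ds))
         then v (rhs e) a j * vectors ys as j else 0#) ∎

    density-product : ∀ {m} {es : Vec (Constraint D) m} → All Consistent es → ∀ ds →
      density (Vec.map lhs es) ds ≡
      pushforward (Product D (Vec.map rhs es)) (Product D (Vec.map lhs es)) (productMap es)
        (density (Vec.map rhs es)) ds
    density-product {es = es} cs ds = begin
      sum (vectors xs ds)     ≡⟨ sum-cong-≗ (vectors-product cs ds) ⟩
      sum (λ j → sumOver (Product D ys) λ as → if hit as then vectors ys as j else 0#)
                              ≡⟨ ∑-comm (λ j i → if hit (FinSet.from (Product D ys) i) then vectors ys (FinSet.from (Product D ys) i) j else 0#) ⟩
      sumOver (Product D ys) (λ as → sum λ j → if hit as then vectors ys as j else 0#)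
                              ≡⟨ sumOver-cong (Product D ys) (λ as → pull (hit as) (vectors ys as)) ⟩
      sumOver (Product D ys) (λ as → if hit as then density ys as else 0#) ∎
      where
      xs = Vec.map lhs es
      ys = Vec.map rhs es
      hit : Tuple ys → Bool
      hit as = does (FinSet._≟_ (Product D xs) (productMap es as) ds)
      pull : ∀ b (f : Vector F N) → sum (λ j → if b then f j else 0#) ≡ (if b then sum f else 0#)
      pull true  f = refl
      pull false f = sum-zero {N} {λ _ → 0#} λ _ → refl

    -- Vectors that are products of at most `m` members. Counting factors this way tracks whether
    -- (o) and (p), which tolerate k - 2 further factors, may still be applied.
    data Short : ℕ → Vector F N → Set where
      one : ∀ {m z} → z ≗ 𝟏 → Short m z
      mul : ∀ {m u w z} → Member u → Short m w → z ≗ u ∙ w → Short (suc m) z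

    -- The axioms take an exact number of factors; missing ones are supplied by the vector 1, which
    -- is a member.
    short-factors : ∀ {m n z} → m ≤ n → Short m z →
                    ∃ λ (us : Vec (Vector F N) n) → All Member us × z ≗ product us
    short-factors {n = n} _ (one z≗𝟏) = Vec.replicate n 𝟏 , ones∈ n , λ j → trans (z≗𝟏 j) (sym (ones n j))
      where
      ones∈ : ∀ n → All Member (Vec.replicate n 𝟏)
      ones∈ zero    = []
      ones∈ (suc n) = 1∈ ∷ ones∈ n
      ones : ∀ n → product (Vec.replicate n 𝟏) ≗ 𝟏
      ones zero    j = refl
      ones (suc n) j = trans (*-identityˡ _) (ones n j)
    short-factors (s≤s m≤n) (mul {u = u} u∈ w z≗) with short-factors m≤n w
    ... | us , us∈ , w≗ = u ∷ us , u∈ ∷ us∈ , λ j → trans (z≗ j) (cong (u j *_) (w≗ j))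

    orthogonal : ∀ x {d d′ z m} → d ≢ d′ → m ≤ k″ → Short m z → sum (v x d ∙ v x d′ ∙ z) ≡ 0#
    orthogonal x {d} {d′} d≢d′ m≤k″ short with short-factors m≤k″ short
    ... | us , us∈ , z≗ = trans (sum-cong-≗ λ j → cong (λ y → v x d j * (v x d′ j * y)) (z≗ j)) (v-orthogonal x d≢d′ us us∈)

    idempotent : ∀ x d {z m} → m ≤ k″ → Short m z → sum (v x d ∙ v x d ∙ z) ≡ sum (v x d ∙ z)
    idempotent x d m≤k″ short with short-factors m≤k″ short
    ... | us , us∈ , z≗ = trans (sum-cong-≗ λ j → cong (λ y → v x d j * (v x d j * y)) (z≗ j))
      (trans (v-idempotent x d us us∈) (sum-cong-≗ λ j → cong (v x d j *_) (sym (z≗ j))))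

    -- For every position of xs the entries of es that σ sends there: the i-th
    -- list holds es j for all j with σ j = i.
    Fibres : ∀ {m} → Vec X m → Set
    Fibres = All (λ x → List ∣ D x ∣)

    size : ∀ {m} {xs : Vec X m} → Fibres xs → ℕ
    size []       = 0
    size (c ∷ cs) = List.length c ℕ.+ size cs

    -- The indicator that every entry of the list equals `d`.
    hit : ∀ x → ∣ D x ∣ → List ∣ D x ∣ → F
    hit x d []      = 1#
    hit x d (e ∷ c) = if does (FinSet._≟_ (D x) d e) then hit x d c else 0#

    hits : ∀ {m} (xs : Vec X m) → Tuple xs → Fibres xs → F
    hits []       []       []       = 1#
    hits (x ∷ xs) (d ∷ ds) (c ∷ cs) = hit x d c * hits xs ds cs

    monomialOf : ∀ x → List ∣ D x ∣ → Vector F N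
    monomialOf x []      = 𝟏
    monomialOf x (e ∷ c) = v x e ∙ monomialOf x c

    fibreProduct : ∀ {m} (xs : Vec X m) → Fibres xs → Vector F N
    fibreProduct []       []       = 𝟏
    fibreProduct (x ∷ xs) (c ∷ cs) = monomialOf x c ∙ fibreProduct xs cs

    short-monomial : ∀ x c {m z} → Short m z → Short (List.length c ℕ.+ m) (monomialOf x c ∙ z)
    short-monomial x []      short = subst-short short
      where
      subst-short : ∀ {m z} → Short m z → Short m (𝟏 ∙ z)
      subst-short (one z≗)       = one λ j → trans (*-identityˡ _) (z≗ j)
      subst-short (mul u∈ w z≗)  = mul u∈ w λ j → trans (*-identityˡ _) (z≗ j)
    short-monomial x (e ∷ c) short = mul (v∈ x e) (short-monomial x c short) λ j → *-assoc _ _ _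

    short-resp : ∀ {m z z′} → z ≗ z′ → Short m z → Short m z′
    short-resp eq (one z≗)      = one λ j → trans (sym (eq j)) (z≗ j)
    short-resp eq (mul u∈ w z≗) = mul u∈ w λ j → trans (sym (eq j)) (z≗ j)

    short-fibres : ∀ {n} (xs : Vec X n) cs {m z} → Short m z → Short (size cs ℕ.+ m) (fibreProduct xs cs ∙ z)
    short-fibres []       []       short = short-resp (λ j → sym (*-identityˡ _)) short
    short-fibres (x ∷ xs) (c ∷ cs) {m} {z} short = subst (λ n → Short n (fibreProduct (x ∷ xs) (c ∷ cs) ∙ z)) (sym (ℕₚ.+-assoc (List.length c) (size cs) m))
      (short-resp (λ j → sym (*-assoc (monomialOf x c j) (fibreProduct xs cs j) (z j))) (short-monomial x c (short-fibres xs cs short)))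

    -- Each further entry of the fibre is either `e` and is absorbed by (p), or differs from `e` and
    -- makes the product vanish by (o). The bound leaves at most k - 2 factors beside the two
    -- compared.
    collapse : ∀ x e c {m z} → Short m z → suc (List.length c ℕ.+ m) ≤ k →
               sum (v x e ∙ (monomialOf x c ∙ z)) ≡ hit x e c * sum (v x e ∙ z)
    collapse x e [] {z = z} short len =
      trans (sum-cong-≗ λ j → cong (v x e j *_) (*-identityˡ (z j))) (sym (*-identityˡ _))
    collapse x e (a ∷ c) {m} {z} short len = begin
      sum (v x e ∙ ((v x a ∙ monomialOf x c) ∙ z))   ≡⟨ sum-cong-≗ (λ j → cong (v x e j *_) (*-assoc _ _ _)) ⟩
      sum (v x e ∙ v x a ∙ w)                        ≡⟨ case (FinSet._≟_ (D x) e a) ⟩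
      (if does (FinSet._≟_ (D x) e a) then hit x e c else 0#) * sum (v x e ∙ z) ∎
      where
      w : Vector F N
      w = monomialOf x c ∙ z
      w-short : Short (List.length c ℕ.+ m) w
      w-short = short-monomial x c short
      len′ : List.length c ℕ.+ m ≤ k″
      len′ = ℕₚ.≤-pred (ℕₚ.≤-pred len)
      case : (e≟a : Dec (e ≡ a)) → sum (v x e ∙ v x a ∙ w) ≡ (if does e≟a then hit x e c else 0#) * sum (v x e ∙ z)
      case (yes refl) = trans (idempotent x e len′ w-short) (collapse x e c short (ℕₚ.≤-pred (ℕₚ.m≤n⇒m≤1+n len)))
      case (no e≢a)   = trans (orthogonal x e≢a len′ w-short) (sym (zeroˡ _))

    -- Slot by slot: an empty fibre is summed out, a nonempty one determines
    -- the entry and is collapsed.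
    sum-hits : ∀ {n} (xs : Vec X n) (cs : Fibres xs) {m z} → Short m z → size cs ℕ.+ m ≤ k →
               sumOver (Product D xs) (λ ds → hits xs ds cs * sum (vectors xs ds ∙ z)) ≡
               sum (fibreProduct xs cs ∙ z)
    sum-hits [] [] {z = z} short len = trans
      (sumOver-only (Product D []) (λ ds → hits [] ds [] * sum (vectors [] ds ∙ z)) [] λ { [] ds≢ → contradiction refl ds≢ })
      (*-identityˡ _)
    sum-hits (x ∷ xs) ([] ∷ cs) {z = z} short len = begin
      sumOver (Product D (x ∷ xs)) (λ ds → hits (x ∷ xs) ds ([] ∷ cs) * sum (vectors (x ∷ xs) ds ∙ z))
        ≡⟨ sumOver-∷ D x xs (λ ds → hits (x ∷ xs) ds ([] ∷ cs) * sum (vectors (x ∷ xs) ds ∙ z)) ⟩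
      (sumOver (D x) λ d → sumOver (Product D xs) λ ds → (1# * hits xs ds cs) * sum ((v x d ∙ vectors xs ds) ∙ z))
        ≡⟨ sumOver-swap (D x) (Product D xs) (λ d ds → (1# * hits xs ds cs) * sum ((v x d ∙ vectors xs ds) ∙ z)) ⟩
      (sumOver (Product D xs) λ ds → sumOver (D x) λ d → (1# * hits xs ds cs) * sum ((v x d ∙ vectors xs ds) ∙ z))
        ≡⟨ sumOver-cong (Product D xs) inner ⟩
      sumOver (Product D xs) (λ ds → hits xs ds cs * sum (vectors xs ds ∙ z))
        ≡⟨ sum-hits xs cs short len ⟩
      sum (fibreProduct xs cs ∙ z)
        ≡⟨ sum-cong-≗ (λ j → cong (_* z j) (*-identityˡ (fibreProduct xs cs j))) ⟨
      sum ((𝟏 ∙ fibreProduct xs cs) ∙ z) ∎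
      where
      inner : ∀ ds → sumOver (D x) (λ d → (1# * hits xs ds cs) * sum ((v x d ∙ vectors xs ds) ∙ z)) ≡
              hits xs ds cs * sum (vectors xs ds ∙ z)
      inner ds = begin
        sumOver (D x) (λ d → (1# * hits xs ds cs) * sum ((v x d ∙ vectors xs ds) ∙ z))
          ≡⟨ sumOver-*ˡ (D x) (1# * hits xs ds cs) (λ d → sum ((v x d ∙ vectors xs ds) ∙ z)) ⟩
        (1# * hits xs ds cs) * sumOver (D x) (λ d → sum ((v x d ∙ vectors xs ds) ∙ z))
          ≡⟨ cong₂ _*_ (*-identityˡ _) (sumOver-cong (D x) λ d → sum-assoc (v x d) (vectors xs ds) z) ⟩
        hits xs ds cs * sumOver (D x) (λ d → sum (v x d ∙ (vectors xs ds ∙ z)))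
          ≡⟨ cong (hits xs ds cs *_) (sum-v x (vectors xs ds ∙ z)) ⟩
        hits xs ds cs * sum (vectors xs ds ∙ z) ∎
    sum-hits (x ∷ xs) ((e ∷ c) ∷ cs) {m} {z} short len = begin
      sumOver (Product D (x ∷ xs)) (λ ds → hits (x ∷ xs) ds ((e ∷ c) ∷ cs) * sum (vectors (x ∷ xs) ds ∙ z))
        ≡⟨ sumOver-∷ D x xs (λ ds → hits (x ∷ xs) ds ((e ∷ c) ∷ cs) * sum (vectors (x ∷ xs) ds ∙ z)) ⟩
      (sumOver (D x) λ d → sumOver (Product D xs) λ ds → term d ds)
        ≡⟨ sumOver-only (D x) _ e (λ d d≢e → sumOver-zero (Product D xs) (off d d≢e)) ⟩
      (sumOver (Product D xs) λ ds → term e ds)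
        ≡⟨ sumOver-cong (Product D xs) on ⟩
      (sumOver (Product D xs) λ ds → hit x e c * (hits xs ds cs * sum (vectors xs ds ∙ (v x e ∙ z))))
        ≡⟨ sumOver-*ˡ (Product D xs) (hit x e c) (λ ds → hits xs ds cs * sum (vectors xs ds ∙ (v x e ∙ z))) ⟩
      hit x e c * sumOver (Product D xs) (λ ds → hits xs ds cs * sum (vectors xs ds ∙ (v x e ∙ z)))
        -- The factor `v x e` moves into the remainder `z`; the extra member is paid for by the
        -- entry `e` of the fibre just removed.
        ≡⟨ cong (hit x e c *_) (sum-hits xs cs (mul (v∈ x e) short λ j → refl) len₁) ⟩
      hit x e c * sum (fibreProduct xs cs ∙ (v x e ∙ z))
        ≡⟨ cong (hit x e c *_) (trans (sym (sum-assoc (fibreProduct xs cs) (v x e) z)) (sum-swap (fibreProduct xs cs) (v x e) z)) ⟩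
      hit x e c * sum (v x e ∙ (fibreProduct xs cs ∙ z))
        ≡⟨ collapse x e c (short-fibres xs cs short) len₂ ⟨
      sum (v x e ∙ (monomialOf x c ∙ (fibreProduct xs cs ∙ z)))
        ≡⟨ sum-cong-≗ (λ j → trans (cong (_* z j) (*-assoc _ _ _)) (trans (*-assoc _ _ _) (cong (v x e j *_) (*-assoc _ _ _)))) ⟨
      sum (((v x e ∙ monomialOf x c) ∙ fibreProduct xs cs) ∙ z) ∎
      where
      len₂ : suc (List.length c ℕ.+ (size cs ℕ.+ m)) ≤ k
      len₂ = subst (_≤ k) (cong suc (ℕₚ.+-assoc (List.length c) (size cs) m)) len
      len₁ : size cs ℕ.+ suc m ≤ k
      len₁ = ℕₚ.≤-trans (ℕₚ.≤-reflexive (ℕₚ.+-suc (size cs) m)) (ℕₚ.≤-trans (s≤s (ℕₚ.m≤n+m _ (List.length c))) len₂)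
      term : ∣ D x ∣ → Tuple xs → F
      term d ds = (hit x d (e ∷ c) * hits xs ds cs) * sum ((v x d ∙ vectors xs ds) ∙ z)
      off : ∀ d → d ≢ e → ∀ ds → term d ds ≡ 0#
      off d d≢e ds = trans (cong (λ y → (y * hits xs ds cs) * sum ((v x d ∙ vectors xs ds) ∙ z)) (if-no (FinSet._≟_ (D x) d e) d≢e))
        (trans (cong (_* sum ((v x d ∙ vectors xs ds) ∙ z)) (zeroˡ _)) (zeroˡ _))
      on : ∀ ds → term e ds ≡ hit x e c * (hits xs ds cs * sum (vectors xs ds ∙ (v x e ∙ z)))
      on ds = trans
        (cong₂ (λ a b → (a * hits xs ds cs) * b) (if-yes (FinSet._≟_ (D x) e e) refl) (sum-swap (v x e) (vectors xs ds) z))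
        (*-assoc _ _ _)

    noFibres : ∀ {n} (xs : Vec X n) → Fibres xs
    noFibres []       = []
    noFibres (x ∷ xs) = [] ∷ noFibres xs

    insert : ∀ {n} (xs : Vec X n) → Fibres xs → ∀ i → ∣ D (Vec.lookup xs i) ∣ → Fibres xs
    insert (x ∷ xs) (c ∷ cs) zero    e = (e ∷ c) ∷ cs
    insert (x ∷ xs) (c ∷ cs) (suc i) e = c ∷ insert xs cs i e

    -- The domain of `σ` has its own size `m`, so that the recursion can shorten it while `xs` stays
    -- fixed.
    fibres : ∀ {n m} (xs : Vec X n) (σ : Fin m → Fin n) → Tuple (Vec.tabulate (Vec.lookup xs ∘ σ)) → Fibres xs
    fibres {m = zero}  xs σ []       = noFibres xs
    fibres {m = suc m} xs σ (e ∷ es) = insert xs (fibres xs (σ ∘ suc) es) (σ zero) e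

    size-fibres : ∀ {n m} (xs : Vec X n) (σ : Fin m → Fin n) es → size (fibres xs σ es) ≡ m
    size-fibres {m = zero} xs σ [] = none xs
      where
      none : ∀ {n} (xs : Vec X n) → size (noFibres xs) ≡ 0
      none []       = refl
      none (x ∷ xs) = none xs
    size-fibres {m = suc m} xs σ (e ∷ es) =
      trans (inserted xs (fibres xs (σ ∘ suc) es) (σ zero) e) (cong suc (size-fibres xs (σ ∘ suc) es))
      where
      inserted : ∀ {n} (xs : Vec X n) cs i e → size (insert xs cs i e) ≡ suc (size cs)
      inserted (x ∷ xs) (c ∷ cs) zero    e = refl
      inserted (x ∷ xs) (c ∷ cs) (suc i) e =
        trans (cong (List.length c ℕ.+_) (inserted xs cs i e)) (ℕₚ.+-suc (List.length c) (size cs))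

    product-fibres : ∀ {n m} (xs : Vec X n) (σ : Fin m → Fin n) es →
      fibreProduct xs (fibres xs σ es) ≗ vectors (Vec.tabulate (Vec.lookup xs ∘ σ)) es
    product-fibres {m = zero} xs σ [] j = none xs
      where
      none : ∀ {n} (xs : Vec X n) → fibreProduct xs (noFibres xs) j ≡ 1#
      none []       = refl
      none (x ∷ xs) = trans (*-identityˡ _) (none xs)
    product-fibres {m = suc m} xs σ (e ∷ es) j =
      trans (inserted xs (fibres xs (σ ∘ suc) es) (σ zero) e) (cong (v _ e j *_) (product-fibres xs (σ ∘ suc) es j))
      where
      inserted : ∀ {n} (xs : Vec X n) cs i e →
                 fibreProduct xs (insert xs cs i e) j ≡ v (Vec.lookup xs i) e j * fibreProduct xs cs j
      inserted (x ∷ xs) (c ∷ cs) zero    e = *-assoc _ _ _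
      inserted (x ∷ xs) (c ∷ cs) (suc i) e =
        trans (cong (monomialOf x c j *_) (inserted xs cs i e)) (x∙yz≈y∙xz _ _ _)

    -- Agreement of `ds` with all fibres is the same conjunction of entrywise equations as equality
    -- of its reindexing with `es`, only grouped by target position.
    hits-fibres : ∀ {n m} (xs : Vec X n) (σ : Fin m → Fin n) es ds →
      hits xs ds (fibres xs σ es) ≡
      (if does (FinSet._≟_ (Product D (Vec.tabulate (Vec.lookup xs ∘ σ))) (tabulate⁺ (λ j → lookup⁺ ds (σ j))) es)
       then 1# else 0#)
    hits-fibres {m = zero} xs σ [] ds =
      trans (none xs ds) (sym (if-yes (FinSet._≟_ (Product D []) [] []) {1#} {0#} refl))
      where
      none : ∀ {n} (xs : Vec X n) ds → hits xs ds (noFibres xs) ≡ 1#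
      none []       []       = refl
      none (x ∷ xs) (d ∷ ds) = trans (*-identityˡ _) (none xs ds)
    hits-fibres {m = suc m} xs σ (e ∷ es) ds = begin
      hits xs ds (insert xs (fibres xs (σ ∘ suc) es) (σ zero) e)
        ≡⟨ inserted xs ds (fibres xs (σ ∘ suc) es) (σ zero) e ⟩
      (if does head≟ then hits xs ds (fibres xs (σ ∘ suc) es) else 0#)
        ≡⟨ cong (λ y → if does head≟ then y else 0#) (hits-fibres xs (σ ∘ suc) es ds) ⟩
      (if does head≟ then (if does tail≟ then 1# else 0#) else 0#)
        ≡⟨ if-× head≟ tail≟ all≟ (cong VecAll.head) (cong VecAll.tail) (cong₂ _∷_) 1# ⟩
      (if does all≟ then 1# else 0#) ∎
      where
      head≟ = FinSet._≟_ (D (Vec.lookup xs (σ zero))) (lookup⁺ ds (σ zero)) e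
      tail≟ = FinSet._≟_ (Product D (Vec.tabulate (Vec.lookup xs ∘ (σ ∘ suc)))) (tabulate⁺ (λ j → lookup⁺ ds (σ (suc j)))) es
      all≟  = FinSet._≟_ (Product D (Vec.tabulate (Vec.lookup xs ∘ σ))) (tabulate⁺ (λ j → lookup⁺ ds (σ j))) (e ∷ es)
      inserted : ∀ {n} (xs : Vec X n) ds cs i e → hits xs ds (insert xs cs i e) ≡
        (if does (FinSet._≟_ (D (Vec.lookup xs i)) (lookup⁺ ds i) e) then hits xs ds cs else 0#)
      inserted (x ∷ xs) (d ∷ ds) (c ∷ cs) zero    e = if-*ʳ (does (FinSet._≟_ (D x) d e)) (hit x d c) (hits xs ds cs)
      inserted (x ∷ xs) (d ∷ ds) (c ∷ cs) (suc i) e = trans (cong (hit x d c *_) (inserted xs ds cs i e))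
        (*-if (does (FinSet._≟_ (D (Vec.lookup xs i)) (lookup⁺ ds i) e)) (hit x d c) (hits xs ds cs))

    density-reindex : ∀ (xs : Vec X k) (σ : Fin k → Fin k) es → density (reindex {Dom = D} σ xs) es ≡
      pushforward (Product D xs) (Product D (reindex {Dom = D} σ xs)) (_⋆ {Dom = D} σ) (density xs) es
    density-reindex xs σ es = begin
      density (reindex {Dom = D} σ xs) es
        ≡⟨ sum-cong-≗ (product-fibres xs σ es) ⟨
      sum (fibreProduct xs cs)
        ≡⟨ sum-cong-≗ (λ j → *-identityʳ (fibreProduct xs cs j)) ⟨
      sum (fibreProduct xs cs ∙ 𝟏)
        -- The fibres together contain exactly `k` entries, so with remainder 1 the budget of
        -- factors is met with equality.
        ≡⟨ sum-hits xs cs {m = 0} (one λ _ → refl) (ℕₚ.≤-reflexive (trans (ℕₚ.+-identityʳ _) (size-fibres xs σ es))) ⟨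
      sumOver (Product D xs) (λ ds → hits xs ds cs * sum (vectors xs ds ∙ 𝟏))
        ≡⟨ sumOver-cong (Product D xs) (λ ds → cong₂ _*_ (hits-fibres xs σ es ds) (sum-cong-≗ λ j → *-identityʳ (vectors xs ds j))) ⟩
      sumOver (Product D xs) (λ ds → (if match ds then 1# else 0#) * density xs ds)
        ≡⟨ sumOver-cong (Product D xs) (λ ds → trans (if-*ʳ (match ds) 1# (density xs ds))
             (cong (λ y → if match ds then y else 0#) (*-identityˡ (density xs ds)))) ⟩
      sumOver (Product D xs) (λ ds → if match ds then density xs ds else 0#) ∎
      where
      cs = fibres xs σ es
      match : Tuple xs → Bool
      match ds = does (FinSet._≟_ (Product D (reindex {Dom = D} σ xs)) (_⋆ {Dom = D} σ ds) es)

    density-constraint : ∀ {e} → e ∈ constraints (pow k 𝒟) → ∀ ds → density (lhs e) ds ≡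
      pushforward (Product D (rhs e)) (Product D (lhs e)) (apply e) (density (rhs e)) ds
    density-constraint e∈ with ∈ₚ.∈-++⁻ (List.map productConstraint (tuples (withIdentities 𝒟) k)) e∈
    density-constraint _ | inj₁ e∈ with ∈ₚ.∈-map⁻ productConstraint e∈
    ... | es , es∈ , refl = density-product (VecAll.map withIdentities-consistent (tuples-∈ (withIdentities 𝒟) k es∈))
    density-constraint _ | inj₂ e∈
      with ∈ₚ.∈-cartesianProductWith⁻ (λ xs σ → reindexConstraint xs (Vec.lookup σ))
             (tuples (elements (Var 𝒟)) k) (tuples (List.allFin k) k) e∈
    ... | xs , table , _ , _ , refl = density-reindex xs (Vec.lookup table)

-- Transfer to the minions and proof of the equivalence.

open Subspace
open Triple using (V; i)

inhabited? : (X : FinSet) → ∣ X ∣ ⊎ ¬ ∣ X ∣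
inhabited? record { size = zero ; index = ix } = inj₂ λ x → case (Inverse.to ix x)
  where
  case : ¬ Fin 0
  case ()
inhabited? record { size = suc _ ; index = ix } = inj₁ (Inverse.from ix zero)

module _ (p : ℕ) (isPrime : Prime p) (k″ : ℕ) (𝒟 : LC) where

  private
    instance
      p-nonZero : NonZero p
      p-nonZero = prime⇒nonZero isPrime

    𝔽 : PrimeField
    𝔽 = ℤₚ p isPrime

    k : ℕ
    k = suc (suc k″)

    D = Dom 𝒟

  open Linear 𝔽

  pow⇒𝒱 : Solution (pow k 𝒟) (𝒵 p) → Solution 𝒟 (𝒱 p k)
  pow⇒𝒱 s = record
    { value     = λ x → triple W (𝟙 p) (λ d → v (x , d)) , record
      -- The vector 1 is not a generator; it lies in the span as the sum of the vectors belonging to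
      -- `x`.
      { i∈V  = ≗-span (v-sum x) (member-sum p W _ λ n → generator (x , FinSet.from (D x) n))
      ; v∈V  = λ d → generator (x , d)
      ; ax-i = (λ _ → refl) , trans (sum-monomial-v [] z≤n) (Moment.Moments.Ψ-[] moments)
      ; ax-s = v-sum x
      ; ax-o = λ a≢b _ us∈ → v-orthogonal x a≢b us∈
      ; ax-p = λ a _ us∈ → v-idempotent (x , a) us∈
      }
    ; satisfies = ListAll.tabulate λ e∈ → same (id , id) (λ _ → refl) (v-constraint e∈)
    }
    where
    open Solution s
    moments : Moment.Moments 𝔽 𝒟 k
    moments = Moment.FromPower.moments 𝔽 𝒟 k″ (proj₁ ∘ value) (proj₂ ∘ value) (ListAll.lookup satisfies)
    open Vectors 𝔽 𝒟 moments
    W : Subspace p N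
    W = record { member = Span ; ≗-resp = ≗-span ; 0-closed = 0-span ; +-closed = +-span ; *-closed = *-span }

  -- Carries the axioms from the triple that a variable comes with to its replacement over the
  -- shared space.
  isElement-resp : ∀ {E} {s t : Triple p E} → _≈ₜ_ p s t → IsElement p k s → IsElement p k t
  isElement-resp {E} (same {V = V} {v = v} (f , g) i≗ v≗) el = record
    { i∈V  = f (≗-resp V i≗ i∈V)
    ; v∈V  = λ a → f (≗-resp V (v≗ a) (v∈V a))
    ; ax-i = (λ j → trans (sym (i≗ j)) (proj₁ ax-i j)) , trans (sum-cong-≗ (sym ∘ i≗)) (proj₂ ax-i)
    ; ax-s = λ j → trans (sum-cong-≗ λ n → sym (v≗ (FinSet.from E n) j)) (trans (ax-s j) (i≗ j))
    ; ax-o = λ {a} {b} a≢b us us∈ → trans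
        (sum-cong-≗ λ j → cong₂ _*_ (sym (v≗ a j)) (cong (_* ⨀ p us j) (sym (v≗ b j))))
        (ax-o a≢b us (VecAll.map g us∈))
    ; ax-p = λ a us us∈ → trans
        (sum-cong-≗ λ j → cong₂ _*_ (sym (v≗ a j)) (cong (_* ⨀ p us j) (sym (v≗ a j))))
        (trans (ax-p a us (VecAll.map g us∈)) (sum-cong-≗ λ j → cong (_* ⨀ p us j) (v≗ a j)))
    }
    where open IsElement el

  vectors-≗ : ∀ {E : FinSet} {N} {V : Subspace p N} {i : Vector F N} {v w : ∣ E ∣ → Vector F N} →
              _≈ₜ_ p {E} (triple V i v) (triple V i w) → ∀ a → v a ≗ w a
  vectors-≗ (same _ _ v≗) = v≗

  module _ (connected : Connected 𝒟) (s : Solution 𝒟 (𝒱 p k)) (x₀ : ∣ Var 𝒟 ∣) where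

    open Solution s

    private
      t₀ : Triple p (D x₀)
      t₀ = proj₁ (value x₀)

    -- Equal triples need only extensionally equal subspaces; naming `V t₀` and `i t₀` here gives
    -- all variables literally the same ambient dimension, space and unit vector, and only the
    -- vectors `w` still vary.
    Shared : ∣ Var 𝒟 ∣ → Set₁
    Shared x = ∃ λ w → _≈ₜ_ p (proj₁ (value x)) (triple (V t₀) (i t₀) w)

    edge : ∀ {e} → e ∈ constraints 𝒟 →
           _≈ₜ_ p (proj₁ (value (lhs e))) (mapTriple p (D (rhs e)) (D (lhs e)) (apply e) (proj₁ (value (rhs e))))
    edge = ListAll.lookup satisfies

    shared-lhs : ∀ {e} → e ∈ constraints 𝒟 → Shared (rhs e) → Shared (lhs e)
    shared-lhs {e} e∈ (w , eq) = _ ,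
      ≈ₜ-trans p (edge e∈) (mapTriple-cong p (D (rhs e)) (D (lhs e)) {apply e} {apply e} (λ _ → refl) eq)

    -- A map of triples leaves the space and the unit vector alone, so sharing also passes backwards
    -- along a constraint, with the vectors of `rhs e` kept as they are.
    shared-rhs : ∀ {e} → e ∈ constraints 𝒟 → Shared (lhs e) → Shared (rhs e)
    shared-rhs {e} e∈ (w , eq) = unmap (proj₁ (value (rhs e))) (≈ₜ-trans p (≈ₜ-sym p (edge e∈)) eq)
      where
      unmap : ∀ t → _≈ₜ_ p (mapTriple p (D (rhs e)) (D (lhs e)) (apply e) t) (triple (V t₀) (i t₀) w) →
              ∃ λ u → _≈ₜ_ p t (triple (V t₀) (i t₀) u)
      unmap (triple _ _ v) (same V≐ i≗ _) = v , same V≐ i≗ (λ _ _ → refl)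

    walk : ∀ {x y} → EqClosure (Adjacent 𝒟) x y → Shared x → Shared y
    walk ε                                    = id
    walk (fwd (_ , e∈ , refl , refl) ◅ steps) = walk steps ∘ shared-rhs e∈
    walk (bwd (_ , e∈ , refl , refl) ◅ steps) = walk steps ∘ shared-lhs e∈

    shared : ∀ x → Shared x
    shared x = walk (connected x₀ x) (_ , ≈ₜ-refl p)

    private
      w : ∀ x → ∣ D x ∣ → Vector F _
      w x = proj₁ (shared x)

      element : ∀ x → IsElement p k (triple (V t₀) (i t₀) (w x))
      element x = isElement-resp (proj₂ (shared x)) (proj₂ (value x))

      open module El x = IsElement (element x)

      w-constraint : ∀ {e} → e ∈ constraints 𝒟 → ∀ d j → w (lhs e) d j ≡
                     fibreSum p (D (rhs e)) (D (lhs e)) (apply e) (λ a → w (rhs e) a j) d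
      w-constraint {e} e∈ = vectors-≗ (≈ₜ-trans p (≈ₜ-sym p (proj₂ (shared (lhs e)))) (≈ₜ-trans p (edge e∈)
        (mapTriple-cong p (D (rhs e)) (D (lhs e)) {apply e} {apply e} (λ _ → refl) (proj₂ (shared (rhs e))))))

      module Power = PowerSolution.FromVectors 𝔽 𝒟 k″ (member (V t₀)) w v∈V
        (≗-resp (V t₀) (proj₁ (ax-i x₀)) (i∈V x₀))
        (trans (sum-cong-≗ (sym ∘ proj₁ (ax-i x₀))) (proj₂ (ax-i x₀)))
        (λ x j → trans (ax-s x j) (proj₁ (ax-i x) j))
        ax-o
        ax-p
        w-constraint

    inhabited⇒pow : Solution (pow k 𝒟) (𝒵 p)
    inhabited⇒pow = record
      { value     = λ xs → Power.density xs , Power.density-sum xs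
      ; satisfies = ListAll.tabulate Power.density-constraint
      }

  𝒱⇒pow : Connected 𝒟 → Solution 𝒟 (𝒱 p k) → Solution (pow k 𝒟) (𝒵 p)
  𝒱⇒pow connected s with inhabited? (Var 𝒟)
  ... | inj₁ x₀    = inhabited⇒pow connected s x₀
  -- There is no base variable to start from, but a tuple of positive length has a first entry, so
  -- the power has no variables either.
  ... | inj₂ empty = record
    { value     = λ { (x ∷ _) → contradiction x empty }
    ; satisfies = ListAll.tabulate λ {e} _ → contradiction (Vec.head (lhs e)) empty
    }

theorem4p4 : (p : ℕ) (isPrime : Prime p) (k : ℕ) → 2 ≤ k → (𝒟 : LC) → Connected 𝒟 →
    Solution 𝒟 (𝒱 p {{prime⇒nonZero isPrime}} k) ⇔ Solution (pow k 𝒟) (𝒵 p {{prime⇒nonZero isPrime}})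
theorem4p4 p isPrime (suc (suc k″)) (s≤s (s≤s z≤n)) 𝒟 connected =
  mk⇔ (𝒱⇒pow p isPrime k″ 𝒟 connected) (pow⇒𝒱 p isPrime k″ 𝒟)
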